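{- The four graph parameters $\delta_\chi$, $\delta_{\mathrm{hom}}$, $\delta_{\mathrm{VC}}$ and $\delta_{\mathrm B}$ are pairwise distinct; that is, for any two different parameters $\delta_*,\delta_{**}$ among these four, there exists a graph $H$ with $\delta_*(H)\ne\delta_{**}(H)$.
   Context: All graphs are finite and simple. A graph is $H$-free if it contains no (not necessarily induced) subgraph isomorphic to $H$; it is maximal $H$-free if it is $H$-free and adding any missing edge creates a copy of $H$. $\delta(G)$ denotes minimum degree. The chromatic threshold $\delta_\chi(H)$ is the infimum of all $\gamma>0$ for which there is a constant $C=C(\gamma,H)$ such that every $H$-free graph $G$ with $\delta(G)\ge\gamma|V(G)|$ has $\chi(G)\le C$. The homomorphism threshold $\delta_{\mathrm{hom}}(H)$ is the infimum of all $\gamma\ge 0$ for which there exists a (finite) $H$-free graph $F=F(\gamma,H)$ such that every $H$-free graph $G$ with $\delta(G)\ge\gamma|V(G)|$ admits a graph homomorphism to $F$. The VC-dimension $\mathrm{VC}(G)$ of a graph $G$ is the maximum size of a set $S\subseteq V(G)$ such that $\{N_G(v)\cap S: v\in V(G)\}=2^S$. The VC-dimension threshold $\delta_{\mathrm{VC}}(H)$ is the infimum of all $\gamma\ge 0$ for which there exists a constant $C=C(\gamma,H)$ such that every maximal $H$-free graph $G$ with $\delta(G)\ge\gamma|V(G)|$ satisfies $\mathrm{VC}(G)\le C$. A blowup of a graph $F$ is obtained by replacing each vertex of $F$ by a (possibly empty) independent set and each edge of $F$ by a complete bipartite graph between the corresponding sets. The blowup threshold $\delta_{\mathrm B}(H)$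 is the infimum of all $\gamma\ge 0$ for which there exists a (finite) graph $F=F(\gamma,H)$ such that every maximal $H$-free graph $G$ with $\delta(G)\ge\gamma|V(G)|$ is a blowup of $F$. -}

module Defs where

open import Data.Bool using (Bool; false; T; _∧_; _∨_)
open import Data.Bool.Properties using (∨-comm; T?)
open import Data.Fin using (Fin; _≟_)
open import Data.Fin.Properties using (any?; all?)
open import Data.Fin.Subset using (Subset; _⊆_; _∩_; ∣_∣)
open import Data.Fin.Subset.Properties using (_⊆?_; anySubset?)
open import Data.Integer using (+_)
open import Data.List using (filter; upTo)
import Data.List as List
open import Data.List.Extrema.Nat using (min; max)
open import Data.Nat using (ℕ; zero; suc; _≤_)
import Data.Nat.Properties as ℕ
open import Data.Product using (Σ; ∃; ∃-syntax; _×_; _,_)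
open import Data.Rational as ℚ using (ℚ; 0ℚ)
open import Data.Sum using (_⊎_)
open import Data.Vec using (Vec; []; _∷_; lookup)
import Data.Vec as Vec
import Data.Vec.Properties as Vec
import Data.Bool.Properties as Bool
open import Function using (_⇔_; _∘_)
open import Relation.Binary.PropositionalEquality using (_≡_; _≢_; refl; sym; trans; cong₂)
open import Relation.Nullary using (¬_; Dec; yes; no; contradiction; ⌊_⌋)
open import Relation.Nullary.Decidable using (map′; ¬?; _×-dec_; _→-dec_; decidable-stable)
open import Relation.Unary using (Decidable)

-- Two-sided (located) Dedekind cuts.
record ℝ : Set₁ where
  field
    Lower Upper : ℚ → Set
    inhabited   : ∃ Lower × ∃ Upper
    lower-open  : ∀ q → Lower q ⇔ (∃[ r ] q ℚ.< r × Lower r)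
    upper-open  : ∀ q → Upper q ⇔ (∃[ r ] r ℚ.< q × Upper r)
    disjoint    : ∀ q → ¬ (Lower q × Upper q)
    located     : ∀ q r → q ℚ.< r → Lower q ⊎ Upper r

infix 4 _below_ _above_ _·_≤_

_below_ _above_ : ℚ → ℝ → Set
q below γ = ℝ.Lower γ q
q above γ = ℝ.Upper γ q

Nonnegative Positive : ℝ → Set
Nonnegative γ = ∀ q → q above γ → 0ℚ ℚ.< q
Positive    γ = 0ℚ below γ

fromℕ : ℕ → ℚ
fromℕ n = + n ℚ./ 1

-- γ · n ≤ d  is the real inequality γn ≤ d, tested on the rationals below γ.
_·_≤_ : ℝ → ℕ → ℕ → Set
γ · n ≤ d = ∀ q → q below γ → q ℚ.* fromℕ n ℚ.≤ fromℕ d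

-- An extended real x is represented by its set {q ∈ ℚ : x < q} of strict
-- rational upper bounds, which determines it.  Unlike a located cut, the
-- infimum of an arbitrary set of reals always exists in this form:
-- inf S < q iff γ < q for some γ ∈ S.
UpperReal : Set₂
UpperReal = ℚ → Set₁

infimum : (ℝ → Set) → UpperReal
infimum S q = Σ ℝ λ γ → S γ × q above γ

infix 4 _≃_ _≄_

_≃_ _≄_ : UpperReal → UpperReal → Set₁
x ≃ y = ∀ q → x q ⇔ y q
x ≄ y = ¬ (x ≃ y)

record Graph : Set where
  field
    order  : ℕ
    adj    : Fin order → Fin order → Bool
    symm   : ∀ u v → adj u v ≡ adj v u
    irrefl : ∀ v → adj v v ≡ false

open Graph public

V : Graph → Set
V G = Fin (order G)

Adj : (G : Graph) → V G → V G → Set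
Adj G u v = T (adj G u v)

IsHom : (G F : Graph) → (V G → V F) → Set
IsHom G F f = ∀ u v → Adj G u v → Adj F (f u) (f v)

_⟶_ : Graph → Graph → Set
G ⟶ F = Σ (V G → V F) (IsHom G F)

-- H is isomorphic to a (not necessarily induced) subgraph of G.
_⊑_ : Graph → Graph → Set
H ⊑ G = Σ (V H → V G) λ f → (∀ u v → f u ≡ f v → u ≡ v) × IsHom H G f

_-Free_ : Graph → Graph → Set
H -Free G = ¬ (H ⊑ G)

addEdge : (G : Graph) (a b : V G) → a ≢ b → Graph
addEdge G a b a≢b = record
  { order  = order G
  ; adj    = λ u v → adj G u v ∨ (new u v ∨ new v u)
  ; symm   = λ u v → cong₂ _∨_ (symm G u v) (∨-comm (new u v) (new v u))
  ; irrefl = λ v → cong₂ _∨_ (irrefl G v) (cong₂ _∨_ (new-irrefl v) (new-irrefl v))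
  }
  where
  new : V G → V G → Bool
  new u v = ⌊ u ≟ a ⌋ ∧ ⌊ v ≟ b ⌋

  new-irrefl : ∀ v → new v v ≡ false
  new-irrefl v with v ≟ a | v ≟ b
  ... | no _    | _       = refl
  ... | yes _   | no _    = refl
  ... | yes v≡a | yes v≡b = contradiction (trans (sym v≡a) v≡b) a≢b

_-MaximalFree_ : Graph → Graph → Set
H -MaximalFree G =
  H -Free G × (∀ u v (u≢v : u ≢ v) → ¬ Adj G u v → H ⊑ addEdge G u v u≢v)

N : (G : Graph) → V G → Subset (order G)
N G v = Vec.tabulate (adj G v)

degree : (G : Graph) → V G → ℕ
degree G v = ∣ N G v ∣

-- All degrees are below the order, so the default value of min only matters
-- for the graph without vertices, whose minimum degree is taken to be 0.
minDegree : Graph → ℕ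
minDegree G = min (order G) (List.tabulate (degree G))

IsColouring : (G : Graph) {k : ℕ} → Vec (Fin k) (order G) → Set
IsColouring G c = ∀ u v → Adj G u v → lookup c u ≢ lookup c v

Colourable : Graph → ℕ → Set
Colourable G k = Σ (Vec (Fin k) (order G)) (IsColouring G)

anyVec? : ∀ {k n} {P : Vec (Fin k) n → Set} → Decidable P → Dec (∃ P)
anyVec? {n = zero}  P? = map′ (λ p → [] , p) (λ { ([] , p) → p }) (P? [])
anyVec? {n = suc n} P? =
  map′ (λ { (i , c , p) → i ∷ c , p }) (λ { (i ∷ c , p) → i , c , p })
       (any? λ i → anyVec? (P? ∘ (i ∷_)))

colourable? : ∀ G → Decidable (Colourable G)
colourable? G k = anyVec? λ c → all? λ u → all? λ v →
  T? (adj G u v) →-dec ¬? (lookup c u ≟ lookup c v)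

-- Every graph is colourable with as many colours as it has vertices.
χ : Graph → ℕ
χ G = min (order G) (filter (colourable? G) (upTo (suc (order G))))

-- The inclusion {N(v) ∩ S : v ∈ V(G)} ⊆ 2^S being automatic, this is equality.
Shattered : (G : Graph) → Subset (order G) → Set
Shattered G S = ∀ A → A ⊆ S → ∃[ v ] N G v ∩ S ≡ A

shattered? : ∀ G → Decidable (Shattered G)
shattered? G S =
  map′ (λ ¬∃ A → decidable-stable (good? A) (λ ¬good → ¬∃ (A , ¬good)))
       (λ { all (A , ¬good) → ¬good (all A) })
       (¬? (anySubset? (¬? ∘ good?)))
  where
  good? : Decidable (λ A → A ⊆ S → ∃[ v ] N G v ∩ S ≡ A)
  good? A = A ⊆? S →-dec any? λ v → Vec.≡-dec Bool._≟_ (N G v ∩ S) A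

ShattersSize : Graph → ℕ → Set
ShattersSize G d = ∃[ S ] Shattered G S × ∣ S ∣ ≡ d

shattersSize? : ∀ G → Decidable (ShattersSize G)
shattersSize? G d = anySubset? λ S → shattered? G S ×-dec (∣ S ∣ ℕ.≟ d)

-- The empty set is shattered as soon as G has a vertex; the default value 0
-- only matters for the graph without vertices.
VC : Graph → ℕ
VC G = max 0 (filter (shattersSize? G) (upTo (suc (order G))))

-- The fibre of the map over x ∈ V(F) is the (possibly empty) set replacing x.
-- Fibres are independent because F has no loops.
_IsBlowupOf_ : Graph → Graph → Set
G IsBlowupOf F = Σ (V G → V F) λ f → ∀ u v → Adj G u v ⇔ Adj F (f u) (f v)

data Parameter : Set where
  δχ δhom δVC δB : Parameter

MinDegree≥ : ℝ → Graph → Set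
MinDegree≥ γ G = γ · order G ≤ minDegree G

Admissible : Parameter → Graph → ℝ → Set
Admissible δχ H γ = Positive γ ×
  ∃[ C ] (∀ G → H -Free G → MinDegree≥ γ G → χ G ≤ C)
Admissible δhom H γ = Nonnegative γ ×
  ∃[ F ] (H -Free F × (∀ G → H -Free G → MinDegree≥ γ G → G ⟶ F))
Admissible δVC H γ = Nonnegative γ ×
  ∃[ C ] (∀ G → H -MaximalFree G → MinDegree≥ γ G → VC G ≤ C)
Admissible δB H γ = Nonnegative γ ×
  ∃[ F ] (∀ G → H -MaximalFree G → MinDegree≥ γ G → G IsBlowupOf F)

threshold : Parameter → Graph → UpperReal
threshold δ H = infimum (Admissible δ H)

{-# OPTIONS --safe #-}
-- Three graphs separate the four parameters.
--
-- H = C₅ ∪ N·K₁ has δχ, δhom < 1/10 ≤ δVC, δB.  In a C₅-free graph of linear minimum degree pick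
-- greedily vertices xᵢ with pairwise almost disjoint neighbourhoods; there are boundedly many, and
-- the vertices other than xᵢ having three common neighbours with xᵢ are independent.  So χ is
-- bounded, and if N is at least the bound, every dense H-free graph maps to K₄₊ₙ, which is too small
-- to contain H.  On the other hand a C₅-free graph of minimum degree n/10 can be arranged so that in
-- every maximal C₅-free supergraph an arbitrarily large set stays shattered: each adjacency to be
-- kept out would close a 5-cycle.
--
-- W₄ has δVC < 1/2 ≤ δB.  K₂ₖ,₂ₖ with a perfect matching in one side is W₄-free, and in every
-- W₄-free supergraph the matched vertices have distinct neighbourhoods.  Conversely a maximal
-- W₄-free graph of minimum degree close to n/2 is complete bipartite up to a matching in each side,
-- so its VC-dimension is at most 4.
--
-- H = C₄ ∪ K₁ has δχ = 0 < δhom.  Dense H-free graphs have bounded order.  An H-free target of all of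
-- them contains K₄, hence equals K₄, but Tutte's construction gives C₄-free graphs that are not
-- 4-colourable.
module Submission where

open import Data.Bool using (Bool; true; false; T; not; _∧_; if_then_else_)
open import Data.Bool.Properties using (T?; T-≡; T-∧; T-∨)
open import Data.Empty using (⊥)
open import Data.Fin using (Fin; zero; suc; _≟_)
import Data.Fin as Fin
open import Data.Fin.Patterns
open import Data.Fin.Properties using (any?; all?; *↔×; +↔⊎; 2↔Bool)
import Data.Fin.Properties as Fin
open import Data.Fin.Subset using (Subset; inside; outside; _∈_; _∉_; _⊆_; _∩_; _∪_; _─_; _-_; ⁅_⁆; ∁; ∣_∣; Nonempty)
open import Data.Fin.Subset.Properties
import Data.Integer as ℤ
import Data.Integer.Properties as ℤ
open import Data.List using (List; []; _∷_; upTo; filter; cartesianProduct; allFin)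
open import Data.List.Extrema.Nat using (min≤v⁺; v≤min⁺; min≤xs; min≤⊤; max≤v⁺; v≤max⁺)
open import Data.List.Membership.DecPropositional using () renaming (_∈?_ to [_]_∈L?_)
import Data.List.Membership.Propositional as List
import Data.List.Membership.Propositional.Properties as List
open import Data.List.Relation.Unary.All using (All; []; _∷_)
import Data.List.Relation.Unary.All as All
import Data.List.Relation.Unary.All.Properties as All
import Data.List.Relation.Unary.Any as Any
open import Data.Nat using (ℕ; zero; suc; _+_; _*_; _^_; _≤_; _<_; z≤n; s≤s; z<s; _<ᵇ_; _≤ᵇ_; _≤?_; _<?_; NonZero)
open import Data.Nat.DivMod using (_/_; _%_; m≡m%n+[m/n]*n; m%n<n)
import Data.Nat.Properties as ℕ
open import Data.Nat.Tactic.RingSolver using (solve-∀)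
open import Data.Product using (Σ; ∃-syntax; _×_; _,_; proj₁; proj₂)
open import Data.Product.Function.NonDependent.Propositional using (_×-↔_)
import Data.Product.Properties as Product
open import Data.Rational using (ℚ; 0ℚ)
import Data.Rational as ℚ
import Data.Rational.Properties as ℚ
open import Data.Rational.Unnormalised using (mkℚᵘ; *≤*; *<*)
import Data.Rational.Unnormalised as ℚᵘ
import Data.Rational.Unnormalised.Properties as ℚᵘ
open import Data.Sum using (_⊎_; inj₁; inj₂; [_,_]′; swap)
open import Data.Sum.Function.Propositional using (_⊎-↔_)
open import Data.Unit using (⊤; tt)
open import Data.Vec using (Vec; []; _∷_; lookup; tabulate; here; there)
import Data.Vec as Vec
open import Data.Vec.N-ary using (N-ary; _$ⁿ_)
import Data.Vec.Properties as Vec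
open import Data.Vec.Relation.Unary.All using ([]; _∷_)
open import Data.Vec.Relation.Unary.AllPairs using ([]; _∷_)
open import Data.Vec.Relation.Unary.Unique.Propositional using (Unique)
open import Data.Vec.Relation.Unary.Unique.Propositional.Properties using (lookup-injective)
open import Function using (_⇔_; mk⇔; _∘_; Equivalence; Injective; _↔_; Inverse; Injection)
open import Function.Properties.Inverse using (↔-trans; ↔-refl; ↔⇒↣)
import Relation.Binary as B
open import Relation.Binary.Definitions using (tri<; tri≈; tri>)
open import Relation.Binary.PropositionalEquality
open import Relation.Nullary using (¬_; Dec; yes; no; does; contradiction; ⌊_⌋)
open import Relation.Nullary.Decidable using (toWitness; fromWitness; isYes; does-⇔; dec-false; ¬¬-excluded-middle; map′; ¬?; _⊎-dec_; _×-dec_; _→-dec_; from-yes; decidable-stable)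
open import Relation.Unary using (Decidable)
open import Defs

-- Linear arithmetic

data Expr (k : ℕ) : Set where
  var  : Fin k → Expr k
  con  : ℕ → Expr k
  _⊕_  : Expr k → Expr k → Expr k
  _⊛_  : ℕ → Expr k → Expr k

infixl 6 _⊕_
infixl 7 _⊛_

⟦_⟧ : ∀ {k} → Expr k → Vec ℕ k → ℕ
⟦ var i ⟧ ρ = lookup ρ i
⟦ con c ⟧ ρ = c
⟦ e ⊕ f ⟧ ρ = ⟦ e ⟧ ρ + ⟦ f ⟧ ρ
⟦ c ⊛ e ⟧ ρ = c * ⟦ e ⟧ ρ

constant : ∀ {k} → Expr k → ℕ
constant (var i) = 0
constant (con c) = c
constant (e ⊕ f) = constant e + constant f
constant (c ⊛ e) = c * constant e

unit : ∀ {k} → Fin k → Vec ℕ k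
unit zero    = 1 ∷ Vec.replicate _ 0
unit (suc i) = 0 ∷ unit i

coefficients : ∀ {k} → Expr k → Vec ℕ k
coefficients (var i) = unit i
coefficients (con c) = Vec.replicate _ 0
coefficients (e ⊕ f) = Vec.zipWith _+_ (coefficients e) (coefficients f)
coefficients (c ⊛ e) = Vec.map (c *_) (coefficients e)

dot : ∀ {k} → Vec ℕ k → Vec ℕ k → ℕ
dot []       []       = 0
dot (c ∷ cs) (x ∷ xs) = c * x + dot cs xs

dot-0 : ∀ {k} (ρ : Vec ℕ k) → dot (Vec.replicate k 0) ρ ≡ 0
dot-0 []      = refl
dot-0 (x ∷ ρ) = dot-0 ρ

dot-unit : ∀ {k} (i : Fin k) ρ → dot (unit i) ρ ≡ lookup ρ i
dot-unit zero    (x ∷ ρ) = trans (cong₂ _+_ (ℕ.*-identityˡ x) (dot-0 ρ)) (ℕ.+-identityʳ x)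
dot-unit (suc i) (x ∷ ρ) = dot-unit i ρ

dot-+ : ∀ {k} (as bs ρ : Vec ℕ k) → dot (Vec.zipWith _+_ as bs) ρ ≡ dot as ρ + dot bs ρ
dot-+ []       []       []      = refl
dot-+ (a ∷ as) (b ∷ bs) (x ∷ ρ) rewrite dot-+ as bs ρ = lemma a b x (dot as ρ) (dot bs ρ)
  where
  lemma : ∀ a b x y z → (a + b) * x + (y + z) ≡ a * x + y + (b * x + z)
  lemma = solve-∀

dot-* : ∀ {k} c (as ρ : Vec ℕ k) → dot (Vec.map (c *_) as) ρ ≡ c * dot as ρ
dot-* c []       []      = sym (ℕ.*-zeroʳ c)
dot-* c (a ∷ as) (x ∷ ρ) rewrite dot-* c as ρ = lemma c a x (dot as ρ)
  where
  lemma : ∀ c a x y → c * a * x + c * y ≡ c * (a * x + y)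
  lemma = solve-∀

-- The normal form depends on the expression alone, so `absurdᵇ` can judge a combination of
-- inequalities by evaluation.
⟦⟧-linear : ∀ {k} (e : Expr k) ρ → ⟦ e ⟧ ρ ≡ constant e + dot (coefficients e) ρ
⟦⟧-linear (var i) ρ = sym (dot-unit i ρ)
⟦⟧-linear (con c) ρ = sym (trans (cong (c +_) (dot-0 ρ)) (ℕ.+-identityʳ c))
⟦⟧-linear (e ⊕ f) ρ
  rewrite ⟦⟧-linear e ρ | ⟦⟧-linear f ρ | dot-+ (coefficients e) (coefficients f) ρ =
  lemma (constant e) (dot (coefficients e) ρ) (constant f) (dot (coefficients f) ρ)
  where
  lemma : ∀ a b c d → a + b + (c + d) ≡ a + c + (b + d)
  lemma = solve-∀
⟦⟧-linear (c ⊛ e) ρ rewrite ⟦⟧-linear e ρ | dot-* c (coefficients e) ρ =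
  ℕ.*-distribˡ-+ c (constant e) (dot (coefficients e) ρ)

_≤*ᵇ_ : ∀ {k} → Vec ℕ k → Vec ℕ k → Bool
[]       ≤*ᵇ []       = true
(a ∷ as) ≤*ᵇ (b ∷ bs) = (a ≤ᵇ b) ∧ (as ≤*ᵇ bs)

dot-mono : ∀ {k} (as bs ρ : Vec ℕ k) → T (as ≤*ᵇ bs) → dot as ρ ≤ dot bs ρ
dot-mono []       []       []      _ = z≤n
dot-mono (a ∷ as) (b ∷ bs) (x ∷ ρ) t =
  let a≤b , as≤bs = Equivalence.to (T-∧ {a ≤ᵇ b}) t
  in ℕ.+-mono-≤ (ℕ.*-monoˡ-≤ x (ℕ.≤ᵇ⇒≤ a b a≤b)) (dot-mono as bs ρ as≤bs)

infix 5 _⊴_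
infix 4 _∙_

record Inequality (k : ℕ) : Set where
  constructor _⊴_
  field lhs rhs : Expr k

record Weighted (k : ℕ) : Set where
  constructor _∙_
  field
    weight     : ℕ
    inequality : Inequality k

Holds : ∀ {k} → Vec ℕ k → Weighted k → Set
Holds ρ (c ∙ l ⊴ r) = ⟦ l ⟧ ρ ≤ ⟦ r ⟧ ρ

combine : ∀ {k} → List (Weighted k) → Inequality k
combine []                = con 0 ⊴ con 0
combine ((c ∙ l ⊴ r) ∷ hs) = let l′ ⊴ r′ = combine hs in c ⊛ l ⊕ l′ ⊴ c ⊛ r ⊕ r′

combine-holds : ∀ {k} ρ (hs : List (Weighted k)) → All (Holds ρ) hs → Holds ρ (1 ∙ combine hs)
combine-holds ρ []                []       = z≤n
combine-holds ρ ((c ∙ l ⊴ r) ∷ hs) (p ∷ ps) =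
  ℕ.+-mono-≤ (ℕ.*-monoʳ-≤ c p) (combine-holds ρ hs ps)

absurdᵇ : ∀ {k} → Inequality k → Bool
absurdᵇ (l ⊴ r) = (constant r <ᵇ constant l) ∧ (coefficients r ≤*ᵇ coefficients l)

-- Farkas: the weights certify that the hypotheses have no common solution.
farkas : ∀ {k} (f : N-ary k (Expr k) (List (Weighted k))) (ρ : Vec ℕ k) →
  let hs = f $ⁿ Vec.map var (Vec.allFin k) in
  {T (absurdᵇ (combine hs))} → All (Holds ρ) hs → ⊥
farkas {k} f ρ {t} ps = ℕ.<⇒≱ r<l (combine-holds ρ hs ps)
  where
  hs : List (Weighted k)
  hs = f $ⁿ Vec.map var (Vec.allFin k)
  l r : Expr k
  l = Inequality.lhs (combine hs)
  r = Inequality.rhs (combine hs)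
  -- Variables range over the naturals, so coefficientwise comparison bounds the variable parts, and
  -- the constants make the inequality strict.
  r<l : ⟦ r ⟧ ρ < ⟦ l ⟧ ρ
  r<l rewrite ⟦⟧-linear r ρ | ⟦⟧-linear l ρ =
    let c , d = Equivalence.to (T-∧ {constant r <ᵇ constant l}) t
    in ℕ.+-mono-<-≤ (ℕ.<ᵇ⇒< (constant r) (constant l) c) (dot-mono (coefficients r) (coefficients l) ρ d)

-- Finite sets

subset : ∀ {n} {P : Fin n → Set} → Decidable P → Subset n
subset P? = tabulate (⌊_⌋ ∘ P?)

∈-tabulate : ∀ {n} (f : Fin n → Bool) {x : Fin n} → x ∈ tabulate f ⇔ T (f x)
∈-tabulate f {x} = mk⇔
  (λ x∈ → Equivalence.from T-≡ (trans (sym (Vec.lookup∘tabulate f x)) (Vec.[]=⇒lookup x∈)))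
  (λ fx → Vec.lookup⇒[]= x _ (trans (Vec.lookup∘tabulate f x) (Equivalence.to T-≡ fx)))

∈-subset⁺ : ∀ {n} {P : Fin n → Set} (P? : Decidable P) {x : Fin n} → P x → x ∈ subset P?
∈-subset⁺ P? {x} px = Equivalence.from (∈-tabulate (⌊_⌋ ∘ P?)) (fromWitness {a? = P? x} px)

∈-subset⁻ : ∀ {n} {P : Fin n → Set} (P? : Decidable P) {x : Fin n} → x ∈ subset P? → P x
∈-subset⁻ P? {x} x∈ = toWitness {a? = P? x} (Equivalence.to (∈-tabulate (⌊_⌋ ∘ P?)) x∈)

x∈p─q⁻ : ∀ {n} (p q : Subset n) {x : Fin n} → x ∈ p ─ q → x ∈ p × x ∉ q
x∈p─q⁻ (true  ∷ p) (outside ∷ q) here       = here , λ ()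
x∈p─q⁻ (b     ∷ p) (inside  ∷ q) (there x∈) =
  let x∈p , x∉q = x∈p─q⁻ p q x∈ in there x∈p , λ { (there x∈q) → x∉q x∈q }
x∈p─q⁻ (b     ∷ p) (outside ∷ q) (there x∈) =
  let x∈p , x∉q = x∈p─q⁻ p q x∈ in there x∈p , λ { (there x∈q) → x∉q x∈q }

∣p∪q∣+∣p∩q∣ : ∀ {n} (p q : Subset n) → ∣ p ∪ q ∣ + ∣ p ∩ q ∣ ≡ ∣ p ∣ + ∣ q ∣
∣p∪q∣+∣p∩q∣ []          []          = refl
∣p∪q∣+∣p∩q∣ (true  ∷ p) (true  ∷ q) = cong suc (trans (ℕ.+-suc _ _)
  (trans (cong suc (∣p∪q∣+∣p∩q∣ p q)) (sym (ℕ.+-suc _ _))))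
∣p∪q∣+∣p∩q∣ (true  ∷ p) (false ∷ q) = cong suc (∣p∪q∣+∣p∩q∣ p q)
∣p∪q∣+∣p∩q∣ (false ∷ p) (true  ∷ q) = trans (cong suc (∣p∪q∣+∣p∩q∣ p q)) (sym (ℕ.+-suc _ _))
∣p∪q∣+∣p∩q∣ (false ∷ p) (false ∷ q) = ∣p∪q∣+∣p∩q∣ p q

∣p∪q∣≤∣p∣+∣q∣ : ∀ {n} (p q : Subset n) → ∣ p ∪ q ∣ ≤ ∣ p ∣ + ∣ q ∣
∣p∪q∣≤∣p∣+∣q∣ p q = ℕ.≤-trans (ℕ.m≤m+n _ _) (ℕ.≤-reflexive (∣p∪q∣+∣p∩q∣ p q))

∣p∣≤∣p─q∣+∣p∩q∣ : ∀ {n} (p q : Subset n) → ∣ p ∣ ≤ ∣ p ─ q ∣ + ∣ p ∩ q ∣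
∣p∣≤∣p─q∣+∣p∩q∣ p q = ℕ.≤-trans (p⊆q⇒∣p∣≤∣q∣ split) (∣p∪q∣≤∣p∣+∣q∣ (p ─ q) (p ∩ q))
  where
  split : p ⊆ (p ─ q) ∪ (p ∩ q)
  split {x} x∈p with x ∈? q
  ... | yes x∈q = x∈p∪q⁺ (inj₂ (x∈p∩q⁺ (x∈p , x∈q)))
  ... | no  x∉q = x∈p∪q⁺ (inj₁ (x∈p∧x∉q⇒x∈p─q x∈p x∉q))

∣p∩q∣+∣p─q∣≤∣p∣ : ∀ {n} (p q : Subset n) → ∣ p ∩ q ∣ + ∣ p ─ q ∣ ≤ ∣ p ∣
∣p∩q∣+∣p─q∣≤∣p∣ []          []          = z≤n
∣p∩q∣+∣p─q∣≤∣p∣ (true  ∷ p) (true  ∷ q) = s≤s (∣p∩q∣+∣p─q∣≤∣p∣ p q)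
∣p∩q∣+∣p─q∣≤∣p∣ (true  ∷ p) (false ∷ q) =
  ℕ.≤-trans (ℕ.≤-reflexive (ℕ.+-suc _ _)) (s≤s (∣p∩q∣+∣p─q∣≤∣p∣ p q))
∣p∩q∣+∣p─q∣≤∣p∣ (false ∷ p) (true  ∷ q) = ∣p∩q∣+∣p─q∣≤∣p∣ p q
∣p∩q∣+∣p─q∣≤∣p∣ (false ∷ p) (false ∷ q) = ∣p∩q∣+∣p─q∣≤∣p∣ p q

∣p∣≤∣p-x∣+1 : ∀ {n} (p : Subset n) (x : Fin n) → ∣ p ∣ ≤ ∣ p - x ∣ + 1
∣p∣≤∣p-x∣+1 p x = ℕ.≤-trans (∣p∣≤∣p─q∣+∣p∩q∣ p ⁅ x ⁆)
  (ℕ.+-monoʳ-≤ ∣ p - x ∣ (ℕ.≤-trans (∣p∩q∣≤∣q∣ p ⁅ x ⁆) (ℕ.≤-reflexive (∣⁅x⁆∣≡1 x))))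

x∉p-x : ∀ {n} (p : Subset n) {x : Fin n} → x ∉ p - x
x∉p-x p {x} x∈ = proj₂ (x∈p─q⁻ p ⁅ x ⁆ x∈) (x∈⁅x⁆ x)

0<∣p∣⇒Nonempty : ∀ {n} (p : Subset n) → 0 < ∣ p ∣ → Nonempty p
0<∣p∣⇒Nonempty (true  ∷ p) _ = zero , here
0<∣p∣⇒Nonempty (false ∷ p) h = let x , x∈p = 0<∣p∣⇒Nonempty p h in suc x , there x∈p

∣q∣<∣p∣⇒∃ : ∀ {n} (p q : Subset n) → ∣ q ∣ < ∣ p ∣ → ∃[ x ] x ∈ p × x ∉ q
∣q∣<∣p∣⇒∃ p q q<p =
  let x , x∈ = 0<∣p∣⇒Nonempty (p ─ q) (ℕ.+-cancelʳ-< (∣ p ∩ q ∣) 0 (∣ p ─ q ∣)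
                 (ℕ.≤-trans (s≤s (∣p∩q∣≤∣q∣ p q)) (ℕ.≤-trans q<p (∣p∣≤∣p─q∣+∣p∩q∣ p q))))
  in x , x∈p─q⁻ p q x∈

enumerate : ∀ {n} k (p : Subset n) → k ≤ ∣ p ∣ →
  ∃[ f ] (∀ i → f i ∈ p) × Injective {A = Fin k} _≡_ _≡_ f
enumerate zero    p _   = (λ ()) , (λ ()) , λ { {()} }
enumerate {n} (suc k) p k<p = f , f∈ , f-inj
  where
  head : Nonempty p
  head = 0<∣p∣⇒Nonempty p (ℕ.≤-trans z<s k<p)
  x : Fin n
  x = proj₁ head
  rest = enumerate k (p - x)
    (ℕ.+-cancelʳ-≤ 1 k (∣ p - x ∣) (ℕ.≤-trans (ℕ.≤-reflexive (ℕ.+-comm k 1))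
      (ℕ.≤-trans k<p (∣p∣≤∣p-x∣+1 p x))))
  g : Fin k → Fin n
  g = proj₁ rest
  f : Fin (suc k) → Fin n
  f zero    = x
  f (suc i) = g i
  f∈ : ∀ i → f i ∈ p
  f∈ zero    = proj₂ head
  f∈ (suc i) = p─q⊆p p ⁅ x ⁆ (proj₁ (proj₂ rest) i)
  g≢x : ∀ i → g i ≢ x
  g≢x i eq = x∉p-x p (subst (_∈ p - x) eq (proj₁ (proj₂ rest) i))
  f-inj : Injective _≡_ _≡_ f
  f-inj {zero}  {zero}  _  = refl
  f-inj {zero}  {suc j} eq = contradiction (sym eq) (g≢x j)
  f-inj {suc i} {zero}  eq = contradiction eq (g≢x i)
  f-inj {suc i} {suc j} eq = cong suc (proj₂ (proj₂ rest) eq)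

injection⇒≤∣p∣ : ∀ {n k} (p : Subset n) (f : Fin k → Fin n) →
  Injective _≡_ _≡_ f → (∀ i → f i ∈ p) → k ≤ ∣ p ∣
injection⇒≤∣p∣ {k = zero}  p f inj f∈ = z≤n
injection⇒≤∣p∣ {k = suc k} p f inj f∈ = ℕ.≤-trans
  (s≤s (injection⇒≤∣p∣ (p - f zero) (f ∘ suc) (Fin.suc-injective ∘ inj)
    (λ i → x∈p∧x≢y⇒x∈p-y (f∈ (suc i)) λ eq → Fin.0≢1+n (sym (inj eq)))))
  (x∈p⇒∣p-x∣<∣p∣ (f∈ zero))

image : ∀ {n k} → (Fin k → Fin n) → Subset n
image f = subset (λ y → any? λ i → f i ≟ y)

∣image∣≤ : ∀ {n k} (f : Fin k → Fin n) → ∣ image f ∣ ≤ k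
∣image∣≤ {n} {zero} f = ℕ.≮⇒≥ λ 0< →
  let x , x∈ = 0<∣p∣⇒Nonempty (image f) 0<
  in case (∈-subset⁻ (λ y → any? λ i → f i ≟ y) x∈)
  where
  case : ∀ {y} → ¬ (∃[ i ] f i ≡ y)
  case (() , _)
∣image∣≤ {n} {suc k} f = ℕ.≤-trans
  (p⊆q⇒∣p∣≤∣q∣ cover)
  (ℕ.≤-trans (∣p∪q∣≤∣p∣+∣q∣ ⁅ f zero ⁆ (image (f ∘ suc)))
    (ℕ.+-mono-≤ (ℕ.≤-reflexive (∣⁅x⁆∣≡1 (f zero))) (∣image∣≤ (f ∘ suc))))
  where
  cover : image f ⊆ ⁅ f zero ⁆ ∪ image (f ∘ suc)
  cover {y} y∈ with ∈-subset⁻ (λ y → any? λ i → f i ≟ y) y∈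
  ... | zero  , refl = x∈p∪q⁺ (inj₁ (x∈⁅x⁆ (f zero)))
  ... | suc i , eq   = x∈p∪q⁺ (inj₂ (∈-subset⁺ (λ y → any? λ i → f (suc i) ≟ y) (i , eq)))

bigUnion : ∀ {n k} → (Fin k → Subset n) → Subset n
bigUnion {k = zero}  P = Data.Fin.Subset.⊥
bigUnion {k = suc k} P = P zero ∪ bigUnion (P ∘ suc)

∣p∩bigUnion∣≤ : ∀ {n k} c (p : Subset n) (P : Fin k → Subset n) →
  (∀ i → ∣ p ∩ P i ∣ ≤ c) → ∣ p ∩ bigUnion P ∣ ≤ c * k
∣p∩bigUnion∣≤ {n} {zero} c p P h = ℕ.≤-trans (∣p∩q∣≤∣q∣ p Data.Fin.Subset.⊥)
  (ℕ.≤-trans (ℕ.≤-reflexive (∣⊥∣≡0 n)) z≤n)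
∣p∩bigUnion∣≤ {n} {suc k} c p P h = begin
  ∣ p ∩ (P zero ∪ U) ∣          ≡⟨ cong ∣_∣ (∩-distribˡ-∪ p (P zero) U) ⟩
  ∣ (p ∩ P zero) ∪ (p ∩ U) ∣    ≤⟨ ∣p∪q∣≤∣p∣+∣q∣ (p ∩ P zero) (p ∩ U) ⟩
  ∣ p ∩ P zero ∣ + ∣ p ∩ U ∣    ≤⟨ ℕ.+-mono-≤ (h zero) (∣p∩bigUnion∣≤ c p (P ∘ suc) (h ∘ suc)) ⟩
  c + c * k                     ≡⟨ ℕ.*-suc c k ⟨
  c * suc k                     ∎
  where
  open ℕ.≤-Reasoning
  U = bigUnion (P ∘ suc)

-- Splitting off one set at a time, each meets the union of the later ones in at most `c` times
-- their number; these overlaps add up to at most c k².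
bonferroni : ∀ {n k} a c (P : Fin k → Subset n) → (∀ i → a ≤ ∣ P i ∣) →
  (∀ i j → i ≢ j → ∣ P i ∩ P j ∣ ≤ c) → k * a ≤ n + c * (k * k)
bonferroni {n} a c P large small = ℕ.≤-trans (union P large small)
  (ℕ.+-monoˡ-≤ _ (∣p∣≤n (bigUnion P)))
  where
  union : ∀ {k} (P : Fin k → Subset n) → (∀ i → a ≤ ∣ P i ∣) →
    (∀ i j → i ≢ j → ∣ P i ∩ P j ∣ ≤ c) → k * a ≤ ∣ bigUnion P ∣ + c * (k * k)
  union {zero}  P large small = z≤n
  union {suc k} P large small = begin
    a + k * a                                      ≤⟨ ℕ.+-mono-≤ (large zero) rec ⟩
    ∣ P zero ∣ + (∣ U ∣ + c * (k * k))             ≡⟨ ℕ.+-assoc ∣ P zero ∣ ∣ U ∣ _ ⟨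
    ∣ P zero ∣ + ∣ U ∣ + c * (k * k)               ≡⟨ cong (_+ c * (k * k)) (∣p∪q∣+∣p∩q∣ (P zero) U) ⟨
    ∣ P zero ∪ U ∣ + ∣ P zero ∩ U ∣ + c * (k * k)
      ≤⟨ ℕ.+-monoˡ-≤ _ (ℕ.+-monoʳ-≤ ∣ P zero ∪ U ∣
           (∣p∩bigUnion∣≤ c (P zero) (P ∘ suc) λ i → small zero (suc i) λ ())) ⟩
    ∣ P zero ∪ U ∣ + c * k + c * (k * k)           ≤⟨ ℕ.m≤m+n _ (c * suc k) ⟩
    ∣ P zero ∪ U ∣ + c * k + c * (k * k) + c * suc k ≡⟨ lemma ∣ P zero ∪ U ∣ c k ⟩
    ∣ P zero ∪ U ∣ + c * (suc k * suc k)           ∎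
    where
    open ℕ.≤-Reasoning
    U = bigUnion (P ∘ suc)
    rec = union (P ∘ suc) (large ∘ suc) λ i j i≢j → small (suc i) (suc j) (i≢j ∘ Fin.suc-injective)
    lemma : ∀ u c k → u + c * k + c * (k * k) + c * (1 + k) ≡ u + c * ((1 + k) * (1 + k))
    lemma = solve-∀

-- Rational thresholds

infix 8 _÷_
_÷_ : ℕ → (b : ℕ) → .{{NonZero b}} → ℚ
a ÷ b = ℤ.+ a ℚ./ b

toℚᵘ-÷ : ∀ a b → ℚ.toℚᵘ (a ÷ suc b) ℚᵘ.≃ mkℚᵘ (ℤ.+ a) b
toℚᵘ-÷ a b = ℚ.toℚᵘ-fromℚᵘ (mkℚᵘ (ℤ.+ a) b)

÷-< : ∀ a b c d .{{_ : NonZero b}} .{{_ : NonZero d}} → a * d < c * b → a ÷ b ℚ.< c ÷ d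
÷-< a (suc b) c (suc d) h = ℚ.toℚᵘ-cancel-<
  (ℚᵘ.<-respˡ-≃ (ℚᵘ.≃-sym (toℚᵘ-÷ a b)) (ℚᵘ.<-respʳ-≃ (ℚᵘ.≃-sym (toℚᵘ-÷ c d))
    (*<* (subst₂ ℤ._<_ (ℤ.pos-* a (suc d)) (ℤ.pos-* c (suc b)) (ℤ.+<+ h)))))

÷-scaled : ∀ a b n → ℚ.toℚᵘ (a ÷ suc b ℚ.* fromℕ n) ℚᵘ.≃ mkℚᵘ (ℤ.+ (a * n)) b
÷-scaled a b n = ℚᵘ.≃-trans (ℚ.toℚᵘ-homo-* (a ÷ suc b) (fromℕ n))
  (ℚᵘ.≃-trans (ℚᵘ.*-cong (toℚᵘ-÷ a b) (toℚᵘ-÷ n 0))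
    (ℚᵘ.≃-reflexive (cong₂ mkℚᵘ (sym (ℤ.pos-* a n)) (ℕ.*-identityʳ b))))

÷-·≤⁺ : ∀ a b n m .{{_ : NonZero b}} → a * n ≤ b * m → a ÷ b ℚ.* fromℕ n ℚ.≤ fromℕ m
÷-·≤⁺ a (suc b) n m h = ℚ.toℚᵘ-cancel-≤
  (ℚᵘ.≤-respˡ-≃ (ℚᵘ.≃-sym (÷-scaled a b n)) (ℚᵘ.≤-respʳ-≃ (ℚᵘ.≃-sym (toℚᵘ-÷ m 0))
    (*≤* (subst₂ ℤ._≤_ (sym (ℤ.*-identityʳ (ℤ.+ (a * n))))
      (trans (cong ℤ.+_ (ℕ.*-comm (suc b) m)) (ℤ.pos-* m (suc b))) (ℤ.+≤+ h)))))

÷-·≤⁻ : ∀ a b n m .{{_ : NonZero b}} → a ÷ b ℚ.* fromℕ n ℚ.≤ fromℕ m → a * n ≤ b * m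
÷-·≤⁻ a (suc b) n m h = ℤ.drop‿+≤+ (subst₂ ℤ._≤_ (ℤ.*-identityʳ (ℤ.+ (a * n)))
  (trans (sym (ℤ.pos-* m (suc b))) (cong ℤ.+_ (ℕ.*-comm m (suc b))))
  (ℚᵘ.drop-*≤* (ℚᵘ.≤-respˡ-≃ (÷-scaled a b n) (ℚᵘ.≤-respʳ-≃ (toℚᵘ-÷ m 0) (ℚ.toℚᵘ-mono-≤ h)))))

rational : ℚ → ℝ
rational r = record
  { Lower      = ℚ._< r
  ; Upper      = r ℚ.<_
  ; inhabited  = (r ℚ.- ℚ.1ℚ , below) , (r ℚ.+ ℚ.1ℚ , above)
  ; lower-open = λ q → mk⇔ (λ q<r → let s , q<s , s<r = ℚ.<-dense q<r in s , q<s , s<r)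
                           (λ (s , q<s , s<r) → ℚ.<-trans q<s s<r)
  ; upper-open = λ q → mk⇔ (λ r<q → let s , r<s , s<q = ℚ.<-dense r<q in s , s<q , r<s)
                           (λ (s , s<q , r<s) → ℚ.<-trans r<s s<q)
  ; disjoint   = λ q (q<r , r<q) → ℚ.<-asym q<r r<q
  ; located    = located
  }
  where
  below : r ℚ.- ℚ.1ℚ ℚ.< r
  below = subst (r ℚ.- ℚ.1ℚ ℚ.<_) (ℚ.+-identityʳ r) (ℚ.+-monoʳ-< r (ℚ.negative⁻¹ (ℚ.- ℚ.1ℚ)))
  above : r ℚ.< r ℚ.+ ℚ.1ℚ
  above = subst (ℚ._< r ℚ.+ ℚ.1ℚ) (ℚ.+-identityʳ r) (ℚ.+-monoʳ-< r (ℚ.positive⁻¹ ℚ.1ℚ))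
  located : ∀ p q → p ℚ.< q → p ℚ.< r ⊎ r ℚ.< q
  located p q p<q with ℚ.<-cmp p r
  ... | tri< p<r _ _ = inj₁ p<r
  ... | tri≈ _ refl _ = inj₂ p<q
  ... | tri> _ _ r<p = inj₂ (ℚ.<-trans r<p p<q)

below<above : ∀ γ {p q} → p below γ → q above γ → p ℚ.< q
below<above γ {p} {q} p<γ γ<q with ℚ.<-cmp p q
... | tri< p<q _ _ = p<q
... | tri≈ _ refl _ = contradiction (p<γ , γ<q) (ℝ.disjoint γ p)
... | tri> _ _ q<p = contradiction
  (Equivalence.from (ℝ.lower-open γ q) (p , q<p , p<γ) , γ<q) (ℝ.disjoint γ q)

-- For feeding a graph to an admissible `γ`: every rational tested lies below the cut, hence below
-- the upper bound a / b.
minDegree≥⁺ : ∀ G γ a b .{{_ : NonZero b}} → a ÷ b above γ →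
  a * order G ≤ b * minDegree G → MinDegree≥ γ G
minDegree≥⁺ G γ a b γ<q h p p<γ = ℚ.≤-trans
  (ℚ.*-monoʳ-≤-nonNeg (fromℕ (order G)) {{ℚ.nonNegative (÷-0≤ (order G))}}
    (ℚ.<⇒≤ (below<above γ p<γ γ<q)))
  (÷-·≤⁺ a b (order G) (minDegree G) h)
  where
  ÷-0≤ : ∀ n → 0ℚ ℚ.≤ fromℕ n
  ÷-0≤ n = ℚ.toℚᵘ-cancel-≤ (ℚᵘ.≤-respʳ-≃ (ℚᵘ.≃-sym (toℚᵘ-÷ n 0))
    (*≤* (subst (ℤ.+ 0 ℤ.≤_) (sym (ℤ.*-identityʳ (ℤ.+ n))) (ℤ.+≤+ z≤n))))

-- A cut tests only rationals strictly below it, so a bound by c / d is used through a smaller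
-- fraction a / b.
minDegree≥⁻ : ∀ G a b c d .{{_ : NonZero b}} .{{_ : NonZero d}} → a * d < c * b →
  MinDegree≥ (rational (c ÷ d)) G → a * order G ≤ b * minDegree G
minDegree≥⁻ G a b c d lt h = ÷-·≤⁻ a b (order G) (minDegree G) (h (a ÷ b) (÷-< a b c d lt))

÷-positive : ∀ a b .{{_ : NonZero b}} → 0 < a → 0ℚ ℚ.< a ÷ b
÷-positive a b h = ÷-< 0 1 a b (ℕ.≤-trans h (ℕ.≤-reflexive (sym (ℕ.*-identityʳ a))))

-- Graph parameters

Adj-sym : ∀ G {u v} → Adj G u v → Adj G v u
Adj-sym G {u} {v} = subst T (symm G u v)

Adj⇒≢ : ∀ G {u v} → Adj G u v → u ≢ v
Adj⇒≢ G {u} uv refl = subst T (irrefl G u) uv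

∈N⁺ : ∀ G {v x} → Adj G v x → x ∈ N G v
∈N⁺ G {v} = Equivalence.from (∈-tabulate (adj G v))

∈N⁻ : ∀ G {v x} → x ∈ N G v → Adj G v x
∈N⁻ G {v} = Equivalence.to (∈-tabulate (adj G v))

minDegree≤ : ∀ G v → minDegree G ≤ degree G v
minDegree≤ G v = All.lookup (min≤xs (order G) (Data.List.tabulate (degree G))) (List.∈-tabulate⁺ v)

≤minDegree : ∀ G {d} → d ≤ order G → (∀ v → d ≤ degree G v) → d ≤ minDegree G
≤minDegree G d≤ h = v≤min⁺ d≤ (All.tabulate⁺ h)

ProperColouring : (G : Graph) {k : ℕ} → (V G → Fin k) → Set
ProperColouring G c = ∀ u v → Adj G u v → c u ≢ c v

colourable⁺ : ∀ G {k} (c : V G → Fin k) → ProperColouring G c → Colourable G k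
colourable⁺ G c p = tabulate c , λ u v uv eq → p u v uv
  (trans (sym (Vec.lookup∘tabulate c u)) (trans eq (Vec.lookup∘tabulate c v)))

colourable-mono : ∀ G {k l} → k ≤ l → Colourable G k → Colourable G l
colourable-mono G k≤l (c , p) = colourable⁺ G (λ v → Fin.inject≤ (lookup c v) k≤l)
  λ u v uv eq → p u v uv (Fin.inject≤-injective k≤l k≤l _ _ eq)

colourable-order : ∀ G → Colourable G (order G)
colourable-order G = colourable⁺ G (λ v → v) λ _ _ → Adj⇒≢ G

χ≤ : ∀ G {k} → Colourable G k → χ G ≤ k
χ≤ G {k} c = bound
  where
  sizes : List ℕ
  sizes = filter (colourable? G) (upTo (suc (order G)))
  bound : χ G ≤ k
  bound with k ≤? order G
  ... | yes k≤n = min≤v⁺ (order G) sizes (inj₂ (Any.map (λ { refl → ℕ.≤-refl })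
        (List.∈-filter⁺ (colourable? G) (List.∈-upTo⁺ (s≤s k≤n)) c)))
  ... | no  k≰n = ℕ.≤-trans (min≤⊤ (order G) sizes) (ℕ.≰⇒≥ k≰n)

VC≤ : ∀ G {k} → (∀ S → Shattered G S → ∣ S ∣ ≤ k) → VC G ≤ k
VC≤ G h = max≤v⁺ z≤n (All.map (λ { (S , sh , refl) → h S sh })
  (All.all-filter (shattersSize? G) (upTo (suc (order G)))))

∣S∣≤VC : ∀ G S → Shattered G S → ∣ S ∣ ≤ VC G
∣S∣≤VC G S sh = v≤max⁺ 0 (filter (shattersSize? G) (upTo (suc (order G)))) (inj₂ (Any.map (λ { refl → ℕ.≤-refl })
  (List.∈-filter⁺ (shattersSize? G) (List.∈-upTo⁺ (s≤s (∣p∣≤n S))) (S , sh , refl))))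

-- Constructions of graphs

T-does⁺ : ∀ {A : Set} (a? : Dec A) → A → T (does a?)
T-does⁺ (yes _) _ = _
T-does⁺ (no ¬a) a = ¬a a

T-does⁻ : ∀ {A : Set} (a? : Dec A) → T (does a?) → A
T-does⁻ (yes a) _ = a

↔-injective : ∀ {A B : Set} (A↔B : A ↔ B) → Injective _≡_ _≡_ (Inverse.to A↔B)
↔-injective A↔B = Injection.injective (↔⇒↣ A↔B)

-- On a structured type `X` adjacency can be defined and analysed by pattern matching; the bijection
-- carries it to `Fin n`.
module FromRelation {n : ℕ} {X : Set} (X↔ : Fin n ↔ X) (R : X → X → Set) (R? : B.Decidable R)
  (R-sym : ∀ x y → R x y → R y x) (R-irrefl : ∀ x → ¬ R x x) where

  open Inverse X↔ public using (to; from)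

  relGraph : Graph
  relGraph = record
    { order  = n
    ; adj    = λ u v → does (R? (to u) (to v))
    ; symm   = λ u v → does-⇔ (mk⇔ (R-sym _ _) (R-sym _ _)) (R? (to u) (to v)) (R? (to v) (to u))
    ; irrefl = λ v → dec-false (R? (to v) (to v)) (R-irrefl (to v))
    }

  adj⇒R : ∀ u v → Adj relGraph u v → R (to u) (to v)
  adj⇒R u v = T-does⁻ (R? (to u) (to v))

  to∘from : ∀ x → to (from x) ≡ x
  to∘from = Inverse.strictlyInverseˡ X↔

  R⇒adj : ∀ x y → R x y → Adj relGraph (from x) (from y)
  R⇒adj x y r = T-does⁺ (R? (to (from x)) (to (from y)))
    (subst₂ R (sym (to∘from x)) (sym (to∘from y)) r)

  to-injective : ∀ {u v} → to u ≡ to v → u ≡ v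
  to-injective = ↔-injective X↔

  from-injective : ∀ {x y} → from x ≡ from y → x ≡ y
  from-injective {x} {y} eq = trans (sym (to∘from x)) (trans (cong to eq) (to∘from y))

  injection⇒≤degree : ∀ {k} v (f : Fin k → X) → Injective _≡_ _≡_ f →
    (∀ i → R (to v) (f i)) → k ≤ degree relGraph v
  injection⇒≤degree v f inj vf = injection⇒≤∣p∣ (N relGraph v) (from ∘ f) (inj ∘ from-injective)
    λ i → ∈N⁺ relGraph (T-does⁺ (R? (to v) (to (from (f i)))) (subst (R (to v)) (sym (to∘from (f i))) (vf i)))

Edge : ∀ {n} → List (Fin n × Fin n) → Fin n → Fin n → Set
Edge es u v = (u , v) List.∈ es ⊎ (v , u) List.∈ es

edge? : ∀ {n} (es : List (Fin n × Fin n)) → B.Decidable (Edge es)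
edge? es u v = mem? (u , v) es ⊎-dec mem? (v , u) es
  where mem? = [_]_∈L?_ (Product.≡-dec _≟_ _≟_)

fromEdges : ∀ {n} (es : List (Fin n × Fin n)) → All (λ (u , v) → u ≢ v) es → Graph
fromEdges {n} es loopless = record
  { order  = n
  ; adj    = λ u v → does (edge? es u v)
  ; symm   = λ u v → does-⇔ (mk⇔ swap swap) (edge? es u v) (edge? es v u)
  ; irrefl = λ v → dec-false (edge? es v v)
      [ (λ vv → All.lookup loopless vv refl) , (λ vv → All.lookup loopless vv refl) ]′
  }

fromEdges-hom : ∀ {n} (es : List (Fin n × Fin n)) l G (f : Fin n → V G) →
  All (λ (u , v) → Adj G (f u) (f v)) es → IsHom (fromEdges es l) G f
fromEdges-hom es l G f h u v uv with T-does⁻ (edge? es u v) uv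
... | inj₁ uv∈ = All.lookup h uv∈
... | inj₂ vu∈ = Adj-sym G (All.lookup h vu∈)

infixl 6 _⊎K₁×_

_⊎K₁×_ : Graph → ℕ → Graph
H ⊎K₁× k = record
  { order  = order H + k
  ; adj    = λ u v → adj′ (Fin.splitAt (order H) u) (Fin.splitAt (order H) v)
  ; symm   = λ u v → symm′ (Fin.splitAt (order H) u) (Fin.splitAt (order H) v)
  ; irrefl = λ v → irrefl′ (Fin.splitAt (order H) v)
  }
  where
  adj′ : V H ⊎ Fin k → V H ⊎ Fin k → Bool
  adj′ (inj₁ u) (inj₁ v) = adj H u v
  adj′ _        _        = false
  symm′ : ∀ u v → adj′ u v ≡ adj′ v u
  symm′ (inj₁ u) (inj₁ v) = symm H u v
  symm′ (inj₁ u) (inj₂ v) = refl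
  symm′ (inj₂ u) (inj₁ v) = refl
  symm′ (inj₂ u) (inj₂ v) = refl
  irrefl′ : ∀ v → adj′ v v ≡ false
  irrefl′ (inj₁ v) = irrefl H v
  irrefl′ (inj₂ v) = refl

⊑-order : ∀ H G → H ⊑ G → order H ≤ order G
⊑-order H G (f , inj , _) = Fin.injective⇒≤ {f = f} (inj _ _)

⊎K₁-⊑⁻ : ∀ H k G → (H ⊎K₁× k) ⊑ G → H ⊑ G
⊎K₁-⊑⁻ H k G (f , inj , hom) = f ∘ (Fin._↑ˡ k) , (λ u v eq → Fin.↑ˡ-injective k u v (inj _ _ eq)) ,
  λ u v uv → hom _ _ (adj-↑ˡ u v uv)
  where
  adj-↑ˡ : ∀ u v → Adj H u v → Adj (H ⊎K₁× k) (u Fin.↑ˡ k) (v Fin.↑ˡ k)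
  adj-↑ˡ u v uv rewrite Fin.splitAt-↑ˡ (order H) u k | Fin.splitAt-↑ˡ (order H) v k = uv

-- Isolated vertices may go anywhere outside the image of `H`, and the bound on the order leaves `k`
-- places.
⊎K₁-⊑⁺ : ∀ H k G → order H + k ≤ order G → H ⊑ G → (H ⊎K₁× k) ⊑ G
⊎K₁-⊑⁺ H k G large (f , inj , hom) = h ∘ split , h-inj , h-hom
  where
  split : V (H ⊎K₁× k) → V H ⊎ Fin k
  split = Fin.splitAt (order H)
  others : Subset (order G)
  others = ∁ (image f)
  k≤others : k ≤ ∣ others ∣
  k≤others = ℕ.≤-trans (ℕ.m+n≤o⇒m≤o∸n k (subst (_≤ order G) (ℕ.+-comm (order H) k) large))
    (ℕ.≤-trans (ℕ.∸-monoʳ-≤ (order G) (∣image∣≤ f)) (ℕ.≤-reflexive (sym (∣∁p∣≡n∸∣p∣ (image f)))))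
  fresh = enumerate k others k≤others
  g : Fin k → V G
  g = proj₁ fresh
  f≢g : ∀ u i → f u ≢ g i
  f≢g u i eq = x∈∁p⇒x∉p (proj₁ (proj₂ fresh) i) (∈-subset⁺ (λ y → any? λ j → f j ≟ y) (u , eq))
  h : V H ⊎ Fin k → V G
  h = [ f , g ]′
  h′-inj : ∀ x y → h x ≡ h y → x ≡ y
  h′-inj (inj₁ u) (inj₁ v) eq = cong inj₁ (inj u v eq)
  h′-inj (inj₁ u) (inj₂ j) eq = contradiction eq (f≢g u j)
  h′-inj (inj₂ i) (inj₁ v) eq = contradiction (sym eq) (f≢g v i)
  h′-inj (inj₂ i) (inj₂ j) eq = cong inj₂ (proj₂ (proj₂ fresh) eq)
  h-inj : ∀ u v → h (split u) ≡ h (split v) → u ≡ v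
  h-inj u v eq = begin
    u                                ≡⟨ Fin.join-splitAt (order H) k u ⟨
    Fin.join (order H) k (split u)   ≡⟨ cong (Fin.join (order H) k) (h′-inj (split u) (split v) eq) ⟩
    Fin.join (order H) k (split v)   ≡⟨ Fin.join-splitAt (order H) k v ⟩
    v                                ∎
    where open ≡-Reasoning
  h-hom : IsHom (H ⊎K₁× k) G (h ∘ split)
  h-hom u v uv with split u | split v
  ... | inj₁ x | inj₁ y = hom x y uv

-- Maximal H-free supergraphs

addEdge-new : ∀ G {a b} a≢b → Adj (addEdge G a b a≢b) a b
addEdge-new G {a} {b} a≢b = Equivalence.from (T-∨ {adj G a b}) (inj₂ (Equivalence.from T-∨ (inj₁
  (Equivalence.from (T-∧ {⌊ a ≟ a ⌋}) (fromWitness {a? = a ≟ a} refl , fromWitness {a? = b ≟ b} refl)))))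

addEdge-old : ∀ G {a b} a≢b {u v} → Adj G u v → Adj (addEdge G a b a≢b) u v
addEdge-old G a≢b uv = Equivalence.from T-∨ (inj₁ uv)

addEdge-inv : ∀ G {a b} a≢b {u v} → Adj (addEdge G a b a≢b) u v →
  Adj G u v ⊎ (u ≡ a × v ≡ b ⊎ v ≡ a × u ≡ b)
addEdge-inv G {a} {b} a≢b {u} {v} h with Equivalence.to (T-∨ {adj G u v}) h
... | inj₁ uv  = inj₁ uv
... | inj₂ new with Equivalence.to (T-∨ {⌊ u ≟ a ⌋ ∧ ⌊ v ≟ b ⌋}) new
...   | inj₁ p = let p₁ , p₂ = Equivalence.to (T-∧ {⌊ u ≟ a ⌋}) p
                 in inj₂ (inj₁ (toWitness {a? = u ≟ a} p₁ , toWitness {a? = v ≟ b} p₂))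
...   | inj₂ p = let p₁ , p₂ = Equivalence.to (T-∧ {⌊ v ≟ a ⌋}) p
                 in inj₂ (inj₂ (toWitness {a? = v ≟ a} p₁ , toWitness {a? = u ≟ b} p₂))

-- Fixing the order lets a graph and its supergraphs be compared on the same vertices.
record Spanning (n : ℕ) : Set where
  field
    adjacent : Fin n → Fin n → Bool
    symmetric : ∀ u v → adjacent u v ≡ adjacent v u
    irreflexive : ∀ v → adjacent v v ≡ false

  graph : Graph
  graph = record { order = n ; adj = adjacent ; symm = symmetric ; irrefl = irreflexive }

open Spanning using (graph)

spanning : (G : Graph) → Spanning (order G)
spanning G = record { adjacent = adj G ; symmetric = symm G ; irreflexive = irrefl G }

_⊆ᴱ_ : ∀ {n} → Spanning n → Spanning n → Set
S ⊆ᴱ S′ = ∀ u v → Adj (graph S) u v → Adj (graph S′) u v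

addEdge-⊆ᴱ : ∀ {n} (S S′ : Spanning n) → S ⊆ᴱ S′ → ∀ {a b} a≢b a≢b′ →
  spanning (addEdge (graph S) a b a≢b) ⊆ᴱ spanning (addEdge (graph S′) a b a≢b′)
addEdge-⊆ᴱ S S′ S⊆S′ a≢b a≢b′ u v uv with addEdge-inv (graph S) a≢b {u} {v} uv
... | inj₁ old                  = addEdge-old (graph S′) a≢b′ (S⊆S′ u v old)
... | inj₂ (inj₁ (refl , refl)) = addEdge-new (graph S′) a≢b′
... | inj₂ (inj₂ (refl , refl)) = Adj-sym (addEdge (graph S′) v u a≢b′) (addEdge-new (graph S′) a≢b′)

⊑-⊆ᴱ : ∀ {n} H (S S′ : Spanning n) → S ⊆ᴱ S′ → H ⊑ graph S → H ⊑ graph S′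
⊑-⊆ᴱ H S S′ S⊆S′ (f , inj , hom) = f , inj , λ u v uv → S⊆S′ _ _ (hom u v uv)

Settled : ∀ {n} → Graph → Spanning n → Fin n × Fin n → Set
Settled H S (u , v) = (u≢v : u ≢ v) → ¬ Adj (graph S) u v → H ⊑ addEdge (graph S) u v u≢v

-- Each pair in turn is added unless that creates a copy of `H`; such a copy persists in larger
-- graphs, so settled pairs stay settled. Excluded middle is confined to a double negation, which
-- suffices for refuting thresholds.
settle : ∀ {n} H (ps : List (Fin n × Fin n)) (S : Spanning n) → H -Free graph S →
  ¬ ¬ (Σ (Spanning n) λ S′ → S ⊆ᴱ S′ × H -Free graph S′ × All (Settled H S′) ps)
settle H []             S free k = k (S , (λ _ _ uv → uv) , free , [])
settle H ((u , v) ∷ ps) S free k with u ≟ v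
... | yes u≡v = settle H ps S free λ (S′ , S⊆S′ , free′ , settled) →
  k (S′ , S⊆S′ , free′ , (λ u≢v → contradiction u≡v u≢v) ∷ settled)
... | no  u≢v = ¬¬-excluded-middle λ where
  (yes H⊑) → settle H ps S free λ (S′ , S⊆S′ , free′ , settled) →
    k (S′ , S⊆S′ , free′ , (λ u≢v′ _ →
      ⊑-⊆ᴱ H (spanning (addEdge (graph S) u v u≢v)) (spanning (addEdge (graph S′) u v u≢v′))
           (addEdge-⊆ᴱ S S′ S⊆S′ u≢v u≢v′) H⊑) ∷ settled)
  (no H⋢) → settle H ps (spanning (addEdge (graph S) u v u≢v)) H⋢ λ (S′ , S⁺⊆S′ , free′ , settled) →
    k (S′ , (λ x y xy → S⁺⊆S′ x y (addEdge-old (graph S) u≢v xy)) , free′ ,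
       (λ _ ¬uv → contradiction (S⁺⊆S′ u v (addEdge-new (graph S) u≢v)) ¬uv) ∷ settled)

maximal-extension : ∀ H G → H -Free G →
  ¬ ¬ (Σ (Spanning (order G)) λ S → spanning G ⊆ᴱ S × H -MaximalFree graph S)
maximal-extension H G free k = settle H (cartesianProduct (allFin _) (allFin _)) (spanning G) free
  λ (S , G⊆S , free′ , settled) → k (S , G⊆S , free′ , λ u v →
    All.lookup settled (List.∈-cartesianProduct⁺ (List.∈-allFin u) (List.∈-allFin v)))

degree-mono : ∀ {n} (S S′ : Spanning n) → S ⊆ᴱ S′ → ∀ v → degree (graph S) v ≤ degree (graph S′) v
degree-mono S S′ S⊆S′ v = p⊆q⇒∣p∣≤∣q∣ λ x∈ → ∈N⁺ (graph S′) (S⊆S′ v _ (∈N⁻ (graph S) x∈))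

embed : ∀ {n} (es : List (Fin n × Fin n)) l G (vs : Vec (V G) n) → Unique vs →
  All (λ (u , v) → Adj G (lookup vs u) (lookup vs v)) es → fromEdges es l ⊑ G
embed es l G vs uniq h = lookup vs , lookup-injective uniq , fromEdges-hom es l G (lookup vs) h

-- Graphs without 4-cycles

C₄-edges : List (Fin 4 × Fin 4)
C₄-edges = (0F , 1F) ∷ (1F , 2F) ∷ (2F , 3F) ∷ (3F , 0F) ∷ []

C₄-loopless : All (λ (u , v) → u ≢ v) C₄-edges
C₄-loopless = (λ ()) ∷ (λ ()) ∷ (λ ()) ∷ (λ ()) ∷ []

C₄ : Graph
C₄ = fromEdges C₄-edges C₄-loopless

C₄-⊑ : ∀ G {u v x y} → u ≢ v → x ≢ y →
  Adj G u x → Adj G v x → Adj G u y → Adj G v y → C₄ ⊑ G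
C₄-⊑ G {u} {v} {x} {y} u≢v x≢y ux vx uy vy = embed C₄-edges C₄-loopless G (u ∷ x ∷ v ∷ y ∷ [])
  ((Adj⇒≢ G ux ∷ u≢v ∷ Adj⇒≢ G uy ∷ []) ∷ ((Adj⇒≢ G vx ∘ sym) ∷ x≢y ∷ []) ∷ (Adj⇒≢ G vy ∷ []) ∷ [] ∷ [])
  (ux ∷ Adj-sym G vx ∷ vy ∷ Adj-sym G uy ∷ [])

-- `C₄`-freeness in terms of vertices, the form in which constructions can verify it by cases.
Thin : Graph → Set
Thin G = ∀ u v x y → u ≢ v → Adj G u x → Adj G v x → Adj G u y → Adj G v y → x ≡ y

thin⇒free : ∀ G → Thin G → C₄ -Free G
thin⇒free G thin (f , inj , hom) = contradiction
  (inj 1F 3F (thin (f 0F) (f 2F) (f 1F) (f 3F) (λ eq → contradiction (inj 0F 2F eq) λ ())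
    (hom 0F 1F _) (hom 2F 1F _) (hom 0F 3F _) (hom 2F 3F _))) λ ()

free⇒thin : ∀ G → C₄ -Free G → Thin G
free⇒thin G free u v x y u≢v ux vx uy vy with x ≟ y
... | yes x≡y = x≡y
... | no  x≢y = contradiction (C₄-⊑ G u≢v x≢y ux vx uy vy) free

∣p∣≤1 : ∀ {n} (p : Subset n) → (∀ {x y} → x ∈ p → y ∈ p → x ≡ y) → ∣ p ∣ ≤ 1
∣p∣≤1 p uniq = ℕ.≮⇒≥ λ 2≤ →
  let f , f∈ , inj = enumerate 2 p 2≤ in contradiction (inj {0F} {1F} (uniq (f∈ 0F) (f∈ 1F))) λ ()

-- Graphs without 4-cycles and of large chromatic number

NonColourable : Graph → ℕ → Set
NonColourable G k = ∀ (c : V G → Fin k) → ¬ ProperColouring G c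

-- Pigeonhole by peeling: if the last colour occurs fewer than `n` times, deleting its class leaves
-- enough points for the remaining colours.
monochromatic : ∀ {m} n k (p : Subset m) (c : Fin m → ℕ) → (∀ {x} → x ∈ p → c x < k) →
  k * n < ∣ p ∣ → ∃[ j ] j < k × n ≤ ∣ p ∩ subset (λ x → c x ℕ.≟ j) ∣
monochromatic n zero    p c c< large = let x , x∈ = 0<∣p∣⇒Nonempty p large in contradiction (c< x∈) λ ()
monochromatic n (suc k) p c c< large with n ≤? ∣ p ∩ subset (λ x → c x ℕ.≟ k) ∣
... | yes n≤ = k , ℕ.≤-refl , n≤
... | no  n≰ =
  let q      = subset (λ x → c x ℕ.≟ k)
      j , j<k , n≤ = monochromatic n k (p ─ q) c
        (λ x∈ → let x∈p , x∉q = x∈p─q⁻ p q x∈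
                in ℕ.≤∧≢⇒< (ℕ.≤-pred (c< x∈p)) (x∉q ∘ ∈-subset⁺ (λ x → c x ℕ.≟ k)))
        (ℕ.+-cancelˡ-< n (k * n) (∣ p ─ q ∣) (ℕ.≤-trans large (ℕ.≤-trans (∣p∣≤∣p─q∣+∣p∩q∣ p q)
          (ℕ.≤-trans (ℕ.+-monoʳ-≤ (∣ p ─ q ∣) (ℕ.<⇒≤ (ℕ.≰⇒> n≰))) (ℕ.≤-reflexive (ℕ.+-comm (∣ p ─ q ∣) n))))))
  in j , ℕ.m<n⇒m<1+n j<k , ℕ.≤-trans n≤ (p⊆q⇒∣p∣≤∣q∣ λ x∈ →
       let x∈p─q , x∈r = x∈p∩q⁻ (p ─ q) (subset (λ x → c x ℕ.≟ j)) x∈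
       in x∈p∩q⁺ (p─q⊆p p q x∈p─q , x∈r))

-- Tutte's construction: a set of points, and for every placement g of V(G) among the points a copy
-- of G whose vertex x is joined to g(x) unless another vertex is placed there too.  If the points
-- are coloured, some injective g is monochromatic, and its copy of G must avoid that colour.
module Tutte (G : Graph) (thin : Thin G) (k : ℕ) (non : NonColourable G k) where

  n points : ℕ
  n = order G
  -- One point more than (k + 1) n, so that among k + 1 colours some colour occurs at least n times.
  points = suc (suc k * n)

  Placement : Set
  Placement = Fin (points ^ n)

  at : Placement → V G → Fin points
  at = Fin.finToFun

  X : Set
  X = Fin points ⊎ (Placement × V G)

  -- The uniqueness clause admits arbitrary functions as placements: in each copy at most one vertex
  -- is joined to a given point.
  Attached : Fin points → Placement × V G → Set
  Attached p (g , x) = at g x ≡ p × (∀ y → at g y ≡ p → y ≡ x)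

  R : X → X → Set
  R (inj₁ p)       (inj₁ q)       = ⊥
  R (inj₁ p)       (inj₂ x)       = Attached p x
  R (inj₂ x)       (inj₁ p)       = Attached p x
  R (inj₂ (g , x)) (inj₂ (h , y)) = g ≡ h × Adj G x y

  attached? : ∀ p x → Dec (Attached p x)
  attached? p (g , x) = at g x ≟ p ×-dec all? λ y → at g y ≟ p →-dec y ≟ x

  R? : B.Decidable R
  R? (inj₁ p)       (inj₁ q)       = no λ ()
  R? (inj₁ p)       (inj₂ x)       = attached? p x
  R? (inj₂ x)       (inj₁ p)       = attached? p x
  R? (inj₂ (g , x)) (inj₂ (h , y)) = g ≟ h ×-dec T? (adj G x y)

  R-sym : ∀ x y → R x y → R y x
  R-sym (inj₁ p)       (inj₂ x)       r           = r
  R-sym (inj₂ x)       (inj₁ p)       r           = r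
  R-sym (inj₂ (g , x)) (inj₂ (h , y)) (refl , xy) = refl , Adj-sym G xy

  R-irrefl : ∀ x → ¬ R x x
  R-irrefl (inj₂ (g , x)) (_ , xx) = Adj⇒≢ G xx refl

  X↔ : Fin (points + (points ^ n) * n) ↔ X
  X↔ = ↔-trans +↔⊎ (↔-refl ⊎-↔ *↔×)

  -- A copy vertex is joined to at most one point, and a point to at most one vertex of each copy;
  -- what remains lies inside one copy, where `thin` applies.
  R-thin : ∀ u v x y → u ≢ v → R u x → R v x → R u y → R v y → x ≡ y
  R-thin (inj₁ p) (inj₁ q) (inj₂ _) y u≢v (refl , _) (eq , _) uy vy = contradiction (cong inj₁ eq) u≢v
  R-thin (inj₁ p) (inj₂ (g , v)) (inj₂ (_ , x)) (inj₂ (_ , y)) u≢v (eq , _) (refl , _) (_ , y!) (refl , _) =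
    cong (λ z → inj₂ (g , z)) (y! x eq)
  R-thin (inj₂ (g , u)) (inj₁ p) (inj₂ (_ , x)) (inj₂ (_ , y)) u≢v (refl , _) (eq , _) (refl , _) (_ , y!) =
    cong (λ z → inj₂ (g , z)) (y! x eq)
  R-thin (inj₂ _) (inj₂ _) (inj₁ p) (inj₁ q) u≢v (refl , _) _ (eq , _) _ = cong inj₁ eq
  R-thin (inj₂ (g , u)) (inj₂ (h , v)) (inj₁ p) (inj₂ _) u≢v (_ , u!) (eq , _) (refl , _) (refl , _) =
    contradiction (cong (λ z → inj₂ (g , z)) (sym (u! v eq))) u≢v
  R-thin (inj₂ (g , u)) (inj₂ (h , v)) (inj₂ _) (inj₁ p) u≢v (refl , _) (refl , _) (_ , u!) (eq , _) =
    contradiction (cong (λ z → inj₂ (g , z)) (sym (u! v eq))) u≢v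
  R-thin (inj₂ (g , u)) (inj₂ (_ , v)) (inj₂ (_ , x)) (inj₂ (_ , y)) u≢v (refl , ux) (refl , vx) (refl , uy) (refl , vy) =
    cong (λ z → inj₂ (g , z)) (thin u v x y (u≢v ∘ cong (λ z → inj₂ (g , z))) ux vx uy vy)

  open FromRelation X↔ R R? R-sym R-irrefl public

  relGraph-thin : Thin relGraph
  relGraph-thin u v x y u≢v ux vx uy vy = to-injective
    (R-thin (to u) (to v) (to x) (to y) (u≢v ∘ to-injective)
      (adj⇒R u x ux) (adj⇒R v x vx) (adj⇒R u y uy) (adj⇒R v y vy))

  relGraph-nonColourable : NonColourable relGraph (suc k)
  relGraph-nonColourable c proper = non c′ c′-proper
    where
    pointColour : Fin points → Fin (suc k)
    pointColour p = c (from (inj₁ p))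
    mono = monochromatic n (suc k) Data.Fin.Subset.⊤ (Fin.toℕ ∘ pointColour) (λ _ → Fin.toℕ<n _)
      (ℕ.≤-reflexive (sym (∣⊤∣≡n points)))
    j : ℕ
    j = proj₁ mono
    missing : Fin (suc k)
    missing = Fin.fromℕ< (proj₁ (proj₂ mono))
    place = enumerate n _ (proj₂ (proj₂ mono))
    g : Placement
    g = Fin.funToFin (proj₁ place)
    at-g : ∀ x → at g x ≡ proj₁ place x
    at-g = Fin.finToFun-funToFin (proj₁ place)
    colour-g : ∀ x → pointColour (at g x) ≡ missing
    colour-g x = Fin.toℕ-injective (trans
      (∈-subset⁻ (λ p → Fin.toℕ (pointColour p) ℕ.≟ j)
        (subst (_∈ _) (sym (at-g x)) (proj₂ (x∈p∩q⁻ Data.Fin.Subset.⊤ _ (proj₁ (proj₂ place) x)))))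
      (sym (Fin.toℕ-fromℕ< (proj₁ (proj₂ mono)))))
    attached : ∀ x → Attached (at g x) (g , x)
    attached x = refl , λ y eq → proj₂ (proj₂ place) (trans (sym (at-g y)) (trans eq (at-g x)))
    copy : V G → Fin (suc k)
    copy x = c (from (inj₂ (g , x)))
    copy≢ : ∀ x → missing ≢ copy x
    copy≢ x eq = proper _ _ (R⇒adj (inj₁ (at g x)) (inj₂ (g , x)) (attached x)) (trans (colour-g x) eq)
    -- Removing the avoided colour leaves a colouring of `G` with `k` colours, against `non`.
    c′ : V G → Fin k
    c′ x = Fin.punchOut (copy≢ x)
    c′-proper : ProperColouring G c′
    c′-proper x y xy eq = proper _ _ (R⇒adj (inj₂ (g , x)) (inj₂ (g , y)) (refl , xy))
      (Fin.punchOut-injective (copy≢ x) (copy≢ y) eq)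

opaque

  -- The iteration starts from a single vertex and no colours. It is opaque to keep the enormous
  -- iterated graphs from being unfolded.
  thin-nonColourable : ∀ k → Σ Graph λ G → Thin G × NonColourable G k
  thin-nonColourable zero =
    record { order = 1 ; adj = λ _ _ → false ; symm = λ _ _ → refl ; irrefl = λ _ → refl } ,
    (λ _ _ _ _ _ ()) , λ c _ → contradiction (c zero) λ ()
  thin-nonColourable (suc k) = let G , thin , non = thin-nonColourable k in
    Tutte.relGraph G thin k non , Tutte.relGraph-thin G thin k non , Tutte.relGraph-nonColourable G thin k non

-- Attaching a pendant vertex everywhere makes all degrees positive.
module Corona (G : Graph) (thin : Thin G) where

  X : Set
  X = Bool × V G

  R : X → X → Set
  R (false , x) (false , y) = Adj G x y
  R (true  , x) (true  , y) = ⊥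
  R (_     , x) (_     , y) = x ≡ y

  R? : B.Decidable R
  R? (false , x) (false , y) = T? (adj G x y)
  R? (true  , x) (true  , y) = no λ ()
  R? (false , x) (true  , y) = x ≟ y
  R? (true  , x) (false , y) = x ≟ y

  R-sym : ∀ x y → R x y → R y x
  R-sym (false , x) (false , y) = Adj-sym G
  R-sym (false , x) (true  , y) = sym
  R-sym (true  , x) (false , y) = sym

  R-irrefl : ∀ x → ¬ R x x
  R-irrefl (false , x) xx = Adj⇒≢ G xx refl

  R-thin : ∀ u v x y → u ≢ v → R u x → R v x → R u y → R v y → x ≡ y
  R-thin (false , u) (false , v) (false , x) (false , y) u≢v ux vx uy vy =
    cong (false ,_) (thin u v x y (u≢v ∘ cong (false ,_)) ux vx uy vy)
  R-thin (false , u) (false , v) (true , x) _ u≢v refl refl uy vy = contradiction refl u≢v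
  R-thin (false , u) (false , v) (false , x) (true , y) u≢v ux vx refl refl = contradiction refl u≢v
  R-thin (true , u) _ (false , x) (false , y) u≢v refl vx refl vy = refl
  R-thin (false , u) (true , v) (false , x) (false , y) u≢v ux refl uy refl = refl
  R-thin (false , u) (true , v) (true , x) _ u≢v ux () uy vy
  R-thin (false , u) (true , v) (false , x) (true , y) u≢v ux vx uy ()

  X↔ : Fin (2 * order G) ↔ X
  X↔ = ↔-trans *↔× (2↔Bool ×-↔ ↔-refl)

  open FromRelation X↔ R R? R-sym R-irrefl public

  relGraph-thin : Thin relGraph
  relGraph-thin u v x y u≢v ux vx uy vy = to-injective
    (R-thin (to u) (to v) (to x) (to y) (u≢v ∘ to-injective)
      (adj⇒R u x ux) (adj⇒R v x vx) (adj⇒R u y uy) (adj⇒R v y vy))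

  relGraph-nonColourable : ∀ k → NonColourable G k → NonColourable relGraph k
  relGraph-nonColourable k non c proper = non (λ x → c (from (false , x)))
    λ x y xy → proper _ _ (R⇒adj (false , x) (false , y) xy)

  0<degree : ∀ v → 1 ≤ degree relGraph v
  0<degree v = injection⇒≤degree v (λ _ → mate (to v)) (λ { {0F} {0F} _ → refl }) (λ _ → R-mate (to v))
    where
    mate : X → X
    mate (b , x) = not b , x
    R-mate : ∀ x → R x (mate x)
    R-mate (false , x) = refl
    R-mate (true  , x) = refl

-- Comparing thresholds, spread neighbourhoods and complete graphs

separate : ∀ δ δ′ H q → threshold δ H q → ¬ threshold δ′ H q → threshold δ H ≄ threshold δ′ H
separate δ δ′ H q yes-q no-q eq = no-q (Equivalence.to (eq q) yes-q)

≄-sym : ∀ x y → x ≄ y → y ≄ x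
≄-sym x y x≄y y≃x = x≄y λ q → mk⇔ (Equivalence.from (y≃x q)) (Equivalence.to (y≃x q))

-- The 2 b neighbourhoods have total size at least twice the order, while their union has at most
-- the order; the overlaps must make up the difference.
spread⇒small : ∀ G b c (f : Fin (2 * b) → V G) → order G ≤ b * minDegree G →
  (∀ i j → i ≢ j → ∣ N G (f i) ∩ N G (f j) ∣ ≤ c) → order G ≤ c * (2 * b * (2 * b))
spread⇒small G b c f dense small = ℕ.+-cancelˡ-≤ (order G) _ _ (begin
  order G + order G                     ≤⟨ ℕ.+-mono-≤ dense dense ⟩
  b * minDegree G + b * minDegree G     ≡⟨ lemma b (minDegree G) ⟩
  2 * b * minDegree G
    ≤⟨ bonferroni (minDegree G) c (N G ∘ f) (minDegree≤ G ∘ f) small ⟩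
  order G + c * (2 * b * (2 * b))       ∎)
  where
  open ℕ.≤-Reasoning
  lemma : ∀ b d → b * d + b * d ≡ 2 * b * d
  lemma = solve-∀

module Complete (k : ℕ) = FromRelation {k} ↔-refl _≢_ (λ x y → ¬? (x ≟ y)) (λ x y → _∘ sym) (λ x x≢x → x≢x refl)

K : ℕ → Graph
K k = Complete.relGraph k

colourable⇒hom : ∀ G {k} → Colourable G k → G ⟶ K k
colourable⇒hom G {k} (c , proper) = lookup c , λ u v uv →
  Complete.R⇒adj k (lookup c u) (lookup c v) (proper u v uv)

hom-K-injective : ∀ k F (f : V (K k) → V F) → IsHom (K k) F f → ∀ u v → f u ≡ f v → u ≡ v
hom-K-injective k F f hom u v eq = decidable-stable (u ≟ v) λ u≢v →
  Adj⇒≢ F (hom u v (Complete.R⇒adj k u v u≢v)) eq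

-- C₄ ∪ K₁ separates δχ from δhom

C₄∪K₁ : Graph
C₄∪K₁ = C₄ ⊎K₁× 1

free⇒small∨thin : ∀ G → C₄∪K₁ -Free G → order G ≤ 4 ⊎ Thin G
free⇒small∨thin G free with order G ≤? 4
... | yes small = inj₁ small
... | no  large = inj₂ (free⇒thin G λ C₄⊑G → free (⊎K₁-⊑⁺ C₄ 1 G (ℕ.≰⇒> large) C₄⊑G))

∣N∩N∣≤1 : ∀ G → Thin G → ∀ u v → u ≢ v → ∣ N G u ∩ N G v ∣ ≤ 1
∣N∩N∣≤1 G thin u v u≢v = ∣p∣≤1 (N G u ∩ N G v) λ {x} {y} x∈ y∈ →
  let ux , vx = x∈p∩q⁻ (N G u) (N G v) x∈
      uy , vy = x∈p∩q⁻ (N G u) (N G v) y∈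
  in thin u v x y u≢v (∈N⁻ G ux) (∈N⁻ G vx) (∈N⁻ G uy) (∈N⁻ G vy)

-- Neighbourhoods in a thin graph meet in at most one vertex, so any 2 b vertices are spread. The
-- summands cover the cases of at most 4 vertices, fewer than 2 b, and the rest.
dense⇒bounded : ∀ G b → C₄∪K₁ -Free G → order G ≤ b * minDegree G →
  order G ≤ 4 + (2 * b + 1 * (2 * b * (2 * b)))
dense⇒bounded G b free dense with free⇒small∨thin G free | 2 * b ≤? order G
... | inj₁ small | _         = ℕ.m≤n⇒m≤n+o _ small
... | inj₂ thin  | no  small = ℕ.m≤n⇒m≤o+n 4 (ℕ.m≤n⇒m≤n+o _ (ℕ.≰⇒≥ small))
... | inj₂ thin  | yes large = ℕ.m≤n⇒m≤o+n 4 (ℕ.m≤n⇒m≤o+n (2 * b)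
  (spread⇒small G b 1 (λ i → Fin.inject≤ i large) dense
    λ i j i≢j → ∣N∩N∣≤1 G thin _ _ (i≢j ∘ Fin.inject≤-injective large large i j)))

δχ-C₄∪K₁ : ∀ b .{{_ : NonZero b}} → threshold δχ C₄∪K₁ (1 ÷ b)
-- Of 1/(b+2) < 1/(b+1) < 1/b, the first is used as density and the second is admissible.
δχ-C₄∪K₁ b = rational (1 ÷ suc b) ,
  (÷-positive 1 (suc b) z<s , _ , λ G free dense →
    χ≤ G (colourable-mono G (dense⇒bounded G (suc (suc b)) free
      (subst (_≤ suc (suc b) * minDegree G) (ℕ.*-identityˡ (order G))
        (minDegree≥⁻ G 1 (suc (suc b)) 1 (suc b) (s≤s (ℕ.≤-refl)) dense)))
      (colourable-order G))) ,
  ÷-< 1 (suc b) 1 b (s≤s ℕ.≤-refl)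

δhom-C₄∪K₁ : ∀ G → Thin G → NonColourable G 4 → Σ ℕ λ m → ¬ threshold δhom C₄∪K₁ (1 ÷ suc m)
-- The corona has minimum degree at least 1, so its relative degree exceeds 1/(2 + order G); `K 4`
-- also meets this bound.
δhom-C₄∪K₁ G₀ thin non = suc (order G) , λ (γ , (_ , F , F-free , homs) , γ<q) →
  let f , f-hom = homs (K 4) K₄-free (minDegree≥⁺ (K 4) γ 1 (2 + order G) γ<q K₄-dense)
      g , g-hom = homs G G-free (minDegree≥⁺ G γ 1 (2 + order G) γ<q G-dense)
      f-inj     = hom-K-injective 4 F f f-hom
      -- The image of `K 4` contains a 4-cycle, so a fifth vertex of `F` would complete the
      -- forbidden graph. Maps to `F` are thus 4-colourings.
      F-small   = ℕ.≮⇒≥ λ 4<F → F-free (⊎K₁-⊑⁺ C₄ 1 F 4<F (f , f-inj , λ u v uv →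
                    f-hom u v (Complete.R⇒adj 4 u v (Adj⇒≢ C₄ uv))))
  in relGraph-nonColourable 4 non (λ v → Fin.inject≤ (g v) F-small)
       λ u v uv eq → Adj⇒≢ F (g-hom u v uv) (Fin.inject≤-injective F-small F-small _ _ eq)
  where
  open Corona G₀ thin renaming (relGraph to G)
  K₄-free : C₄∪K₁ -Free K 4
  K₄-free H⊑ = ℕ.<⇒≱ ℕ.≤-refl (⊑-order C₄∪K₁ (K 4) H⊑)
  G-free : C₄∪K₁ -Free G
  G-free H⊑ = thin⇒free G relGraph-thin (⊎K₁-⊑⁻ C₄ 1 G H⊑)
  K₄-dense : 1 * 4 ≤ (2 + order G) * 3
  K₄-dense = ℕ.≤-trans (from-yes (4 ≤? 6)) (ℕ.*-monoˡ-≤ 3 (ℕ.m≤m+n 2 (order G)))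
  G-dense : 1 * order G ≤ (2 + order G) * minDegree G
  G-dense = begin
    1 * order G                     ≡⟨ ℕ.*-comm 1 (order G) ⟩
    order G * 1                     ≤⟨ ℕ.*-monoˡ-≤ 1 (ℕ.m≤n+m (order G) 2) ⟩
    (2 + order G) * 1               ≤⟨ ℕ.*-monoʳ-≤ (2 + order G) 1≤δ ⟩
    (2 + order G) * minDegree G     ∎
    where
    open ℕ.≤-Reasoning
    0<G : 1 ≤ order G
    0<G = ℕ.≰⇒> λ G≤0 → relGraph-nonColourable 4 non
      (λ v → contradiction (ℕ.≤-trans (ℕ.≤-trans z<s (Fin.toℕ<n v)) G≤0) λ ())
      λ u → contradiction (ℕ.≤-trans (ℕ.≤-trans z<s (Fin.toℕ<n u)) G≤0) λ ()
    1≤δ : 1 ≤ minDegree G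
    1≤δ = ≤minDegree G 0<G 0<degree

-- C₅ ∪ N·K₁ separates δχ and δhom from δVC and δB

C₅-edges : List (Fin 5 × Fin 5)
C₅-edges = (0F , 1F) ∷ (1F , 2F) ∷ (2F , 3F) ∷ (3F , 4F) ∷ (4F , 0F) ∷ []

C₅-loopless : All (λ (u , v) → u ≢ v) C₅-edges
C₅-loopless = (λ ()) ∷ (λ ()) ∷ (λ ()) ∷ (λ ()) ∷ (λ ()) ∷ []

C₅ : Graph
C₅ = fromEdges C₅-edges C₅-loopless

C₅-⊑ : ∀ G {u p x q v} → u ≢ x → u ≢ q → p ≢ q → p ≢ v → x ≢ v →
  Adj G u p → Adj G p x → Adj G x q → Adj G q v → Adj G v u → C₅ ⊑ G
C₅-⊑ G {u} {p} {x} {q} {v} u≢x u≢q p≢q p≢v x≢v up px xq qv vu =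
  embed C₅-edges C₅-loopless G (u ∷ p ∷ x ∷ q ∷ v ∷ [])
    ((Adj⇒≢ G up ∷ u≢x ∷ u≢q ∷ (Adj⇒≢ G vu ∘ sym) ∷ []) ∷ (Adj⇒≢ G px ∷ p≢q ∷ p≢v ∷ [])
      ∷ (Adj⇒≢ G xq ∷ x≢v ∷ []) ∷ (Adj⇒≢ G qv ∷ []) ∷ [] ∷ [])
    (up ∷ px ∷ xq ∷ qv ∷ vu ∷ [])

-- Bounded colourings of dense C₅-free graphs

module Colouring (G : Graph) (free : C₅ -Free G) (b : ℕ) (dense : order G ≤ b * minDegree G)
  (large : 2 * (2 * b * (2 * b)) < order G) where

  common : V G → V G → ℕ
  common u v = ∣ N G u ∩ N G v ∣

  Cover : Set
  Cover = Σ ℕ λ k → k ≤ 2 * b × Σ (Fin k → V G) λ f → ∀ v → ∃[ i ] 3 ≤ common v (f i)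

  -- Each uncovered vertex extends the sparse family. A family of 2 b vertices would contradict
  -- `spread⇒small`, so the selection stops at a cover.
  greedy : ∀ fuel k → fuel + k ≡ 2 * b → (f : Fin k → V G) →
    (∀ i j → i ≢ j → common (f i) (f j) ≤ 2) → Cover
  greedy zero       k refl f sparse =
    contradiction (spread⇒small G b 2 f dense sparse) (ℕ.<⇒≱ large)
  greedy (suc fuel) k eq f sparse with all? (λ v → any? λ i → 3 ≤? common v (f i))
  ... | yes covered = k , subst (k ≤_) eq (ℕ.m≤n+m k (suc fuel)) , f , covered
  ... | no ¬covered = greedy fuel (suc k) (trans (ℕ.+-suc fuel k) eq) f′ sparse′
    where
    uncovered = Fin.¬∀⟶∃¬ _ _ (λ v → any? λ i → 3 ≤? common v (f i)) ¬covered
    f′ : Fin (suc k) → V G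
    f′ zero    = proj₁ uncovered
    f′ (suc i) = f i
    new : ∀ i → common (proj₁ uncovered) (f i) ≤ 2
    new i = ℕ.≤-pred (ℕ.≰⇒> λ 3≤ → proj₂ uncovered (i , 3≤))
    sparse′ : ∀ i j → i ≢ j → common (f′ i) (f′ j) ≤ 2
    sparse′ zero    zero    0≢0 = contradiction refl 0≢0
    sparse′ zero    (suc j) _   = new j
    sparse′ (suc i) zero    _   = subst (_≤ 2) (cong ∣_∣ (∩-comm (N G (proj₁ uncovered)) (N G (f i)))) (new i)
    sparse′ (suc i) (suc j) i≢j = sparse i j (i≢j ∘ cong suc)

  cover : Cover
  cover = greedy (2 * b) 0 (ℕ.+-identityʳ (2 * b)) (λ ()) λ ()

  k : ℕ
  k = proj₁ cover

  centre : Fin k → V G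
  centre = proj₁ (proj₂ (proj₂ cover))

  class : V G → Fin k
  class v = proj₁ (proj₂ (proj₂ (proj₂ cover)) v)

  close : ∀ v → 3 ≤ common v (centre (class v))
  close v = proj₂ (proj₂ (proj₂ (proj₂ cover)) v)

  pick : ∀ u x (q : Subset (order G)) → ∣ q ∣ < common u x → ∃[ p ] Adj G u p × Adj G x p × p ∉ q
  pick u x q q< =
    let p , p∈ , p∉q = ∣q∣<∣p∣⇒∃ (N G u ∩ N G x) q q<
        up , xp = x∈p∩q⁻ (N G u) (N G x) p∈
    in p , ∈N⁻ G up , ∈N⁻ G xp , p∉q

  -- An edge u v would close the 5-cycle u p x q v: three common neighbours leave room for p to
  -- avoid v and for q to avoid u and p.
  close⇒nonadjacent : ∀ u v x → u ≢ x → v ≢ x → 3 ≤ common u x → 3 ≤ common v x → ¬ Adj G u v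
  close⇒nonadjacent u v x u≢x v≢x ux vx uv =
    let p , up , xp , p∉ = pick u x ⁅ v ⁆
          (ℕ.≤-trans (s≤s (ℕ.≤-reflexive (∣⁅x⁆∣≡1 v))) (ℕ.≤-trans (ℕ.n≤1+n 2) ux))
        q , vq , xq , q∉ = pick v x (⁅ u ⁆ ∪ ⁅ p ⁆)
          (ℕ.≤-trans (s≤s (ℕ.≤-trans (∣p∪q∣≤∣p∣+∣q∣ ⁅ u ⁆ ⁅ p ⁆)
            (ℕ.≤-reflexive (cong₂ _+_ (∣⁅x⁆∣≡1 u) (∣⁅x⁆∣≡1 p))))) vx)
    in free (C₅-⊑ G u≢x
         (λ u≡q → q∉ (x∈p∪q⁺ (inj₁ (subst (_∈ ⁅ u ⁆) u≡q (x∈⁅x⁆ u)))))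
         (λ p≡q → q∉ (x∈p∪q⁺ (inj₂ (subst (_∈ ⁅ p ⁆) p≡q (x∈⁅x⁆ p)))))
         (x∉⁅y⁆⇒x≢y p∉)
         (v≢x ∘ sym) up (Adj-sym G xp) xq (Adj-sym G vq) (Adj-sym G uv))

  bit : ∀ {A : Set} → Dec A → Fin 2
  bit a? = if does a? then 1F else 0F

  centre? : ∀ v → Dec (v ≡ centre (class v))
  centre? v = v ≟ centre (class v)

  index : V G → Fin (2 * b)
  index v = Fin.inject≤ (class v) (proj₁ (proj₂ cover))

  -- The bit sets the centre apart from its class, since `close⇒nonadjacent` does not cover edges at
  -- the centre.
  colour : V G → Fin (2 * b * 2)
  colour v = Fin.combine (index v) (bit (centre? v))

  class-independent : ∀ u v → class u ≡ class v → (u? : Dec (u ≡ centre (class u)))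
    (v? : Dec (v ≡ centre (class v))) → bit u? ≡ bit v? → ¬ Adj G u v
  class-independent u v class≡ (yes u≡) (yes v≡) _ uv =
    Adj⇒≢ G uv (trans u≡ (trans (cong centre class≡) (sym v≡)))
  class-independent u v class≡ (no u≢) (no v≢) _ =
    close⇒nonadjacent u v (centre (class u)) u≢ (subst (λ i → v ≢ centre i) (sym class≡) v≢)
      (close u) (subst (λ i → 3 ≤ common v (centre i)) (sym class≡) (close v))

  proper : ProperColouring G colour
  proper u v uv eq =
    let same , bits = Fin.combine-injective (index u) (bit (centre? u)) (index v) (bit (centre? v)) eq
    in class-independent u v
         (Fin.inject≤-injective (proj₁ (proj₂ cover)) (proj₁ (proj₂ cover)) (class u) (class v) same)
         (centre? u) (centre? v) bits uv

-- The first summand colours small graphs with all colours distinct; the second counts the colours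
-- from a greedy cover.
colours : ℕ → ℕ
colours b = 2 * (2 * b * (2 * b)) + 2 * b * 2

free⇒colourable : ∀ G b → C₅ -Free G → order G ≤ b * minDegree G → Colourable G (colours b)
free⇒colourable G b free dense with order G ≤? 2 * (2 * b * (2 * b))
... | yes small = colourable-mono G (ℕ.m≤n⇒m≤n+o _ small) (colourable-order G)
... | no  large = colourable-mono G (ℕ.m≤n+m (2 * b * 2) (2 * (2 * b * (2 * b))))
  (colourable⁺ G colour proper)
  where open Colouring G free b dense (ℕ.≰⇒> large)

-- With at least 5 + N vertices the isolated vertices fit, so `G` is C₅-free; with fewer, all
-- colours can be distinct.
⊎K₁-free⇒colourable : ∀ G N b → colours b ≤ 4 + N → (C₅ ⊎K₁× N) -Free G →
  order G ≤ b * minDegree G → Colourable G (4 + N)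
⊎K₁-free⇒colourable G N b enough free dense with 5 + N ≤? order G
... | no  small = colourable-mono G (ℕ.≤-pred (ℕ.≰⇒> small)) (colourable-order G)
... | yes large = colourable-mono G enough
  (free⇒colourable G b (λ C₅⊑G → free (⊎K₁-⊑⁺ C₅ N G large C₅⊑G)) dense)

module _ (N : ℕ) (enough : colours 12 ≤ 4 + N) where

  -- The density is used at 1/12, slightly below the admissible 1/11; hence `colours 12`.
  dense-colourable : ∀ G → (C₅ ⊎K₁× N) -Free G → MinDegree≥ (rational (1 ÷ 11)) G → Colourable G (4 + N)
  dense-colourable G free dense = ⊎K₁-free⇒colourable G N 12 enough free
    (subst (_≤ 12 * minDegree G) (ℕ.*-identityˡ (order G))
      (minDegree≥⁻ G 1 12 1 11 (from-yes (11 <? 12)) dense))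

  δχ-C₅∪NK₁ : threshold δχ (C₅ ⊎K₁× N) (1 ÷ 10)
  δχ-C₅∪NK₁ = rational (1 ÷ 11) ,
    (÷-positive 1 11 z<s , 4 + N , λ G free dense → χ≤ G (dense-colourable G free dense)) ,
    ÷-< 1 11 1 10 (from-yes (10 <? 11))

  δhom-C₅∪NK₁ : threshold δhom (C₅ ⊎K₁× N) (1 ÷ 10)
  δhom-C₅∪NK₁ = rational (1 ÷ 11) ,
    ((λ q r<q → ℚ.<-trans (÷-positive 1 11 z<s) r<q) , K (4 + N) ,
     -- The complete target has one vertex too few to contain the forbidden graph.
     (λ H⊑ → ℕ.<⇒≱ ℕ.≤-refl (⊑-order (C₅ ⊎K₁× N) (K (4 + N)) H⊑)) ,
     λ G free dense → colourable⇒hom G (dense-colourable G free dense)) ,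
    ÷-< 1 11 1 10 (from-yes (10 <? 11))

-- Shattered sets that survive in C₅-free supergraphs

record Pattern (G : Graph) (d : ℕ) : Set where
  field
    element : Fin d → V G
    trace   : (Fin d → Bool) → V G
    traces  : ∀ f i → Adj G (trace f) (element i) ⇔ T (f i)

  -- The trace of the singleton of i sees element i and no other element.
  separated : ∀ i j → (∀ u → Adj G u (element i) → Adj G u (element j)) → i ≡ j
  separated i j twins = toWitness {a? = i ≟ j} (Equivalence.to (traces ⌊ i ≟_⌋ j)
    (twins _ (Equivalence.from (traces ⌊ i ≟_⌋ i) (fromWitness {a? = i ≟ i} refl))))
    where
    ⌊_≟_⌋ : Fin d → Fin d → Bool
    ⌊ i ≟ j ⌋ = isYes (i ≟ j)

  element-injective : Injective _≡_ _≡_ element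
  element-injective {i} {j} eq = separated i j λ u → subst (Adj G u) eq

  shattered : Shattered G (image element)
  shattered A A⊆S = trace f , ⊆-antisym to from
    where
    S : Subset (order G)
    S = image element
    im? : Decidable (λ y → ∃[ i ] element i ≡ y)
    im? y = any? λ i → element i ≟ y
    f : Fin d → Bool
    f i = isYes (element i ∈? A)
    to : N G (trace f) ∩ S ⊆ A
    to {x} x∈ with x∈p∩q⁻ (N G (trace f)) S x∈
    ... | x∈N , x∈S with ∈-subset⁻ im? x∈S
    ...   | i , refl = toWitness {a? = element i ∈? A} (Equivalence.to (traces f i) (∈N⁻ G x∈N))
    from : A ⊆ N G (trace f) ∩ S
    from {x} x∈A with ∈-subset⁻ im? (A⊆S x∈A)
    ... | i , refl = x∈p∩q⁺
      (∈N⁺ G (Equivalence.from (traces f i) (fromWitness {a? = element i ∈? A} x∈A)) , A⊆S x∈A)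

  ≤VC : d ≤ VC G
  ≤VC = ℕ.≤-trans
    (injection⇒≤∣p∣ (image element) element element-injective
      λ i → ∈-subset⁺ (λ y → any? λ i → element i ≟ y) (i , refl))
    (∣S∣≤VC G (image element) shattered)

  -- Vertices in one fibre of a blowup are twins, so separated elements lie in different fibres.
  blowup⇒≤ : ∀ F → G IsBlowupOf F → d ≤ order F
  blowup⇒≤ F (φ , φ-adj) = Fin.injective⇒≤ {f = φ ∘ element} λ {i} {j} eq → separated i j
    λ u uᵢ → Equivalence.from (φ-adj u (element j))
      (subst (Adj F (φ u)) eq (Equivalence.to (φ-adj u (element i)) uᵢ))

lookup-5 : ∀ {A : Set} (f : Fin 5 → A) i → lookup (f 0F ∷ f 1F ∷ f 2F ∷ f 3F ∷ f 4F ∷ []) i ≡ f i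
lookup-5 f 0F = refl
lookup-5 f 1F = refl
lookup-5 f 2F = refl
lookup-5 f 3F = refl
lookup-5 f 4F = refl

next : Fin 5 → Fin 5
next 0F = 1F
next 1F = 2F
next 2F = 3F
next 3F = 4F
next 4F = 0F

-- The 5-cycle (0,c) → (0,c+1) with a pendant vertex (1,c) at each (0,c).
BaseArc : Fin 2 × Fin 5 → Fin 2 × Fin 5 → Set
BaseArc (0F , c) (0F , c′) = c′ ≡ next c
BaseArc (0F , c) (1F , c′) = c ≡ c′
BaseArc (1F , _) _         = ⊥

BaseEdge : Fin 2 × Fin 5 → Fin 2 × Fin 5 → Set
BaseEdge p q = BaseArc p q ⊎ BaseArc q p

baseArc? : B.Decidable BaseArc
baseArc? (0F , c) (0F , c′) = c′ ≟ next c
baseArc? (0F , c) (1F , c′) = c ≟ c′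
baseArc? (1F , _) _         = no λ ()

baseEdge? : B.Decidable BaseEdge
baseEdge? p q = baseArc? p q ⊎-dec baseArc? q p

allBase? : {P : Fin 2 × Fin 5 → Set} → Decidable P → Dec (∀ p → P p)
allBase? P? = map′ (λ f (h , c) → f h c) (λ f h c → f (h , c)) (all? λ h → all? λ c → P? (h , c))

shift : ℕ → Fin 5 → Fin 5
shift zero    c = c
shift (suc k) c = next (shift k c)

-- The ten symmetries c ↦ c + k and c ↦ k - c of the 5-cycle; -c arises as 4 c modulo 5.
dihedral : Fin 2 × Fin 5 → Fin 5 → Fin 5
dihedral (0F , k) c = shift (Fin.toℕ k) c
dihedral (1F , k) c = shift (Fin.toℕ k) (shift (4 * Fin.toℕ c) 0F)

opaque

  dihedral-adj : ∀ σ c → Adj C₅ (dihedral σ c) (dihedral σ (next c))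
  dihedral-adj = from-yes (allBase? λ σ → all? λ c → T? (adj C₅ (dihedral σ c) (dihedral σ (next c))))

  -- A closed walk of length 5 goes once around the 5-cycle.
  closedWalk : ∀ p₀ p₁ → BaseEdge p₀ p₁ → ∀ p₂ → BaseEdge p₁ p₂ → ∀ p₃ → BaseEdge p₂ p₃ →
    ∀ p₄ → BaseEdge p₃ p₄ → BaseEdge p₄ p₀ →
    ∃[ k ] ∃[ r ] ∀ c → lookup (p₀ ∷ p₁ ∷ p₂ ∷ p₃ ∷ p₄ ∷ []) (dihedral (r , k) c) ≡ (0F , c)
  closedWalk = from-yes
    (allBase? λ p₀ → allBase? λ p₁ → baseEdge? p₀ p₁ →-dec allBase? λ p₂ → baseEdge? p₁ p₂ →-dec
     allBase? λ p₃ → baseEdge? p₂ p₃ →-dec allBase? λ p₄ → baseEdge? p₃ p₄ →-dec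
     baseEdge? p₄ p₀ →-dec any? λ k → any? λ r → all? λ c →
     Product.≡-dec _≟_ _≟_ (lookup (p₀ ∷ p₁ ∷ p₂ ∷ p₃ ∷ p₄ ∷ []) (dihedral (r , k) c)) (0F , c))

-- Every vertex of the base graph becomes a class indexed by pairs (i , A) with A ⊆ {1,…,d}, and
-- pendant classes are complete to their neighbours.  A closed walk S → P → Q → R → T → S around
-- the base cycle would carry an i and an A with i ∉ A (edge PQ) and i ∈ A (edge TS).
module ShatteringGraph (d-1 : ℕ) where

  d : ℕ
  d = suc d-1

  I : Set
  I = Fin d × Fin (2 ^ d)

  _∈ᴵ_ : Fin d → Fin (2 ^ d) → Set
  i ∈ᴵ A = Fin.finToFun A i ≡ 1F

  -- Classes 0 to 4 are S, P, Q, R, T. The index i is carried from S to Q, the set A from Q to T.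
  Link : Fin 5 → I → I → Set
  Link 0F (i , _) (j , _) = i ≡ j
  Link 1F (i , _) (j , A) = i ≡ j × ¬ i ∈ᴵ A
  Link 2F (_ , A) (_ , B) = A ≡ B
  Link 3F (_ , A) (_ , B) = A ≡ B
  Link 4F (_ , A) (i , _) = i ∈ᴵ A

  link? : ∀ c → B.Decidable (Link c)
  link? 0F (i , _) (j , _) = i ≟ j
  link? 1F (i , _) (j , A) = i ≟ j ×-dec ¬? (Fin.finToFun A i ≟ 1F)
  link? 2F (_ , A) (_ , B) = A ≟ B
  link? 3F (_ , A) (_ , B) = A ≟ B
  link? 4F (_ , A) (i , _) = Fin.finToFun A i ≟ 1F

  no-cycle : ∀ s p q r t → Link 0F s p → Link 1F p q → Link 2F q r → Link 3F r t → ¬ Link 4F t s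
  no-cycle s p q r t refl (refl , i∉A) refl refl i∈A = i∉A i∈A

  X : Set
  X = (Fin 2 × Fin 5) × I

  Arc : X → X → Set
  Arc ((0F , c) , x) ((0F , c′) , y) = c′ ≡ next c × Link c x y
  Arc ((0F , c) , x) ((1F , c′) , y) = c ≡ c′
  Arc ((1F , _) , _) _               = ⊥

  R : X → X → Set
  R x y = Arc x y ⊎ Arc y x

  arc? : B.Decidable Arc
  arc? ((0F , c) , x) ((0F , c′) , y) = c′ ≟ next c ×-dec link? c x y
  arc? ((0F , c) , x) ((1F , c′) , y) = c ≟ c′
  arc? ((1F , _) , _) _               = no λ ()

  next≢ : ∀ c → c ≢ next c
  next≢ = from-yes (all? λ c → ¬? (c ≟ next c))

  next²≢ : ∀ c → c ≢ next (next c)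
  next²≢ = from-yes (all? λ c → ¬? (c ≟ next (next c)))

  arc-irrefl : ∀ x → ¬ Arc x x
  arc-irrefl ((0F , c) , x) (c≡ , _) = next≢ c c≡
  arc-irrefl ((1F , c) , x) ()

  I↔ : Fin (d * 2 ^ d) ↔ I
  I↔ = *↔×

  X↔ : Fin (2 * 5 * (d * 2 ^ d)) ↔ X
  X↔ = ↔-trans *↔× (*↔× ×-↔ I↔)

  open FromRelation X↔ R (λ x y → arc? x y ⊎-dec arc? y x) (λ _ _ → swap)
    (λ x → [ arc-irrefl x , arc-irrefl x ]′) public

  base : X → Fin 2 × Fin 5
  base = proj₁

  arc⇒base : ∀ x y → Arc x y → BaseArc (base x) (base y)
  arc⇒base ((0F , c) , x) ((0F , c′) , y) (eq , _) = eq
  arc⇒base ((0F , c) , x) ((1F , c′) , y) eq       = eq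
  arc⇒base ((1F , c) , x) _               ()

  R⇒base : ∀ x y → R x y → BaseEdge (base x) (base y)
  R⇒base x y = [ inj₁ ∘ arc⇒base x y , inj₂ ∘ arc⇒base y x ]′

  R⇒link : ∀ c x y → base x ≡ (0F , c) → base y ≡ (0F , next c) → R x y → Link c (proj₂ x) (proj₂ y)
  R⇒link c (_ , x) (_ , y) refl refl (inj₁ (_ , xy))  = xy
  R⇒link c (_ , x) (_ , y) refl refl (inj₂ (c≡ , _)) = contradiction c≡ (next²≢ c)

  -- A 5-cycle projects to a closed walk in the base graph; after a symmetry it visits the core
  -- classes in order, against `no-cycle`.
  C₅-free : C₅ -Free relGraph
  C₅-free (f , _ , hom) = no-cycle (at 0F) (at 1F) (at 2F) (at 3F) (at 4F)
    (link 0F) (link 1F) (link 2F) (link 3F) (link 4F)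
    where
    x : Fin 5 → X
    x = to ∘ f
    edge : ∀ u v → Adj C₅ u v → R (x u) (x v)
    edge u v uv = adj⇒R (f u) (f v) (hom u v uv)
    around = closedWalk _ _ (R⇒base (x 0F) (x 1F) (edge 0F 1F _)) _ (R⇒base (x 1F) (x 2F) (edge 1F 2F _))
      _ (R⇒base (x 2F) (x 3F) (edge 2F 3F _)) _ (R⇒base (x 3F) (x 4F) (edge 3F 4F _))
      (R⇒base (x 4F) (x 0F) (edge 4F 0F _))
    σ : Fin 5 → Fin 5
    σ = dihedral (proj₁ (proj₂ around) , proj₁ around)
    base-σ : ∀ c → base (x (σ c)) ≡ (0F , c)
    base-σ c = trans (sym (lookup-5 (base ∘ x) (σ c))) (proj₂ (proj₂ around) c)
    at : Fin 5 → I
    at c = proj₂ (x (σ c))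
    link : ∀ c → Link c (at c) (at (next c))
    link c = R⇒link c (x (σ c)) (x (σ (next c))) (base-σ c) (base-σ (next c))
      (edge (σ c) (σ (next c)) (dihedral-adj (proj₁ (proj₂ around) , proj₁ around) c))

  -- The pendant classes serve this bound: every vertex is joined to a whole class, a tenth of the
  -- graph.
  degree≥ : ∀ v → d * 2 ^ d ≤ degree relGraph v
  degree≥ v = injection⇒≤degree v (λ i → opposite (base (to v)) , Inverse.to I↔ i)
    (↔-injective I↔ ∘ cong proj₂) λ i → R-opposite (to v) (Inverse.to I↔ i)
    where
    opposite : Fin 2 × Fin 5 → Fin 2 × Fin 5
    opposite (0F , c) = 1F , c
    opposite (1F , c) = 0F , c
    R-opposite : ∀ x i → R x (opposite (base x) , i)
    R-opposite ((0F , c) , _) i = inj₁ refl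
    R-opposite ((1F , c) , _) i = inj₂ refl

  bits : (Fin d → Bool) → Fin d → Fin 2
  bits f i = if f i then 1F else 0F

  code : (Fin d → Bool) → Fin (2 ^ d)
  code f = Fin.funToFin (bits f)

  ∈-code : ∀ f i → i ∈ᴵ code f ⇔ T (f i)
  ∈-code f i rewrite Fin.finToFun-funToFin (bits f) i with f i
  ... | true  = mk⇔ _ λ _ → refl
  ... | false = mk⇔ (λ ()) λ ()

  core : Fin 5 → I → V relGraph
  core c x = from ((0F , c) , x)

  core-edge : ∀ c x y → Link c x y → Adj relGraph (core c x) (core (next c) y)
  core-edge c x y xy = R⇒adj ((0F , c) , x) ((0F , next c) , y) (inj₁ (refl , xy))

  core-≢ : ∀ c c′ x y → c ≢ c′ → core c x ≢ core c′ y
  core-≢ c c′ x y c≢c′ eq = c≢c′ (cong (proj₂ ∘ base) (from-injective {(0F , c) , x} {(0F , c′) , y} eq))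

  module _ (G : Spanning (order relGraph)) (⊆G : spanning relGraph ⊆ᴱ G) (free : C₅ -Free graph G) where

    ∅-index : Fin d → I
    ∅-index i = i , code (λ _ → false)

    trace-index : (Fin d → Bool) → I
    -- Links at T read only the set, so the first coordinate is a default; it exists because `d` is
    -- a successor.
    trace-index f = zero , code f

    s : Fin d → V relGraph
    s i = core 0F (∅-index i)

    t : (Fin d → Bool) → V relGraph
    t f = core 4F (trace-index f)

    -- If i is outside the coded set, the copies of `x` in P, Q, R form a path from `s i` to `t f`,
    -- which this edge would close to a 5-cycle.
    adjacent⇒∈ : ∀ f i → Adj (graph G) (t f) (s i) → T (f i)
    adjacent⇒∈ f i ts = decidable-stable (T? (f i)) λ i∉ → free (C₅-⊑ (graph G)
      (core-≢ 0F 2F (∅-index i) x λ ()) (core-≢ 0F 3F (∅-index i) x λ ())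
      (core-≢ 1F 3F x x λ ()) (core-≢ 1F 4F x (trace-index f) λ ()) (core-≢ 2F 4F x (trace-index f) λ ())
      (⊆G _ _ (core-edge 0F (∅-index i) x refl))
      (⊆G _ _ (core-edge 1F x x (refl , i∉ ∘ Equivalence.to (∈-code f i))))
      (⊆G _ _ (core-edge 2F x x refl))
      (⊆G _ _ (core-edge 3F x (trace-index f) refl)) ts)
      where
      x : I
      x = i , code f

    shatteringPattern : Pattern (graph G) d
    shatteringPattern = record
      { element = s
      ; trace   = t
      ; traces  = λ f i → mk⇔ (adjacent⇒∈ f i)
          λ i∈ → ⊆G _ _ (core-edge 4F (trace-index f) (∅-index i) (Equivalence.from (∈-code f i) i∈))
      }

-- The chosen size exceeds `d` and also makes the graph large enough for the `N` isolated vertices,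
-- so that the extension stays C₅-free.
shattering-extension : ∀ N d → ¬ ¬ (Σ Graph λ G →
  (C₅ ⊎K₁× N) -MaximalFree G × 1 * order G ≤ 10 * minDegree G × Pattern G (suc (5 + N + d)))
shattering-extension N e k = maximal-extension (C₅ ⊎K₁× N) relGraph
  (C₅-free ∘ ⊎K₁-⊑⁻ C₅ N relGraph) λ (G , ⊆G , maximal) →
    k (graph G , maximal , dense G ⊆G , shatteringPattern G ⊆G λ C₅⊑G →
       proj₁ maximal (⊎K₁-⊑⁺ C₅ N (graph G) large C₅⊑G))
  where
  open ShatteringGraph (5 + N + e)
  1≤2^d : 1 ≤ 2 ^ d
  1≤2^d = ℕ.m^n>0 2 d
  large : 5 + N ≤ 10 * (d * 2 ^ d)
  large = begin
    5 + N               ≤⟨ ℕ.m≤n⇒m≤1+n (ℕ.m≤m+n (5 + N) e) ⟩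
    d                   ≡⟨ ℕ.*-identityʳ d ⟨
    d * 1               ≤⟨ ℕ.*-monoʳ-≤ d 1≤2^d ⟩
    d * 2 ^ d           ≤⟨ ℕ.m≤n*m (d * 2 ^ d) 10 ⟩
    10 * (d * 2 ^ d)    ∎
    where open ℕ.≤-Reasoning
  dense : ∀ G → spanning relGraph ⊆ᴱ G → 1 * order relGraph ≤ 10 * minDegree (graph G)
  dense G ⊆G = ℕ.≤-trans (ℕ.≤-reflexive (ℕ.*-identityˡ (order relGraph)))
    (ℕ.*-monoʳ-≤ 10 (≤minDegree (graph G) (ℕ.m≤n*m (d * 2 ^ d) 10)
      λ v → ℕ.≤-trans (degree≥ v) (degree-mono (spanning relGraph) G ⊆G v)))

δVC-C₅∪NK₁ : ∀ N → ¬ threshold δVC (C₅ ⊎K₁× N) (1 ÷ 10)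
δVC-C₅∪NK₁ N (γ , (_ , C , bounded) , γ<q) = shattering-extension N C λ (G , maximal , dense , pat) →
  ℕ.<⇒≱ (s≤s (ℕ.m≤n+m C (5 + N)))
    (ℕ.≤-trans (Pattern.≤VC pat) (bounded G maximal (minDegree≥⁺ G γ 1 10 γ<q dense)))

δB-C₅∪NK₁ : ∀ N → ¬ threshold δB (C₅ ⊎K₁× N) (1 ÷ 10)
δB-C₅∪NK₁ N (γ , (_ , F , blowup) , γ<q) = shattering-extension N (order F) λ (G , maximal , dense , pat) →
  ℕ.<⇒≱ (s≤s (ℕ.m≤n+m (order F) (5 + N)))
    (Pattern.blowup⇒≤ pat F (blowup G maximal (minDegree≥⁺ G γ 1 10 γ<q dense)))

-- W₄ separates δVC from δB

W₄-edges : List (Fin 5 × Fin 5)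
W₄-edges = (0F , 1F) ∷ (0F , 2F) ∷ (0F , 3F) ∷ (0F , 4F) ∷ (1F , 2F) ∷ (2F , 3F) ∷ (3F , 4F) ∷ (4F , 1F) ∷ []

W₄-loopless : All (λ (u , v) → u ≢ v) W₄-edges
W₄-loopless = (λ ()) ∷ (λ ()) ∷ (λ ()) ∷ (λ ()) ∷ (λ ()) ∷ (λ ()) ∷ (λ ()) ∷ (λ ()) ∷ []

W₄ : Graph
W₄ = fromEdges W₄-edges W₄-loopless

W₄-⊑ : ∀ G {w x y a b} → x ≢ y → a ≢ b → Adj G w x → Adj G w y → Adj G w a → Adj G w b →
  Adj G x a → Adj G x b → Adj G y a → Adj G y b → W₄ ⊑ G
W₄-⊑ G {w} {x} {y} {a} {b} x≢y a≢b wx wy wa wb xa xb ya yb =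
  embed W₄-edges W₄-loopless G (w ∷ x ∷ a ∷ y ∷ b ∷ [])
    ((Adj⇒≢ G wx ∷ Adj⇒≢ G wa ∷ Adj⇒≢ G wy ∷ Adj⇒≢ G wb ∷ []) ∷ (Adj⇒≢ G xa ∷ x≢y ∷ Adj⇒≢ G xb ∷ [])
      ∷ ((Adj⇒≢ G ya ∘ sym) ∷ a≢b ∷ []) ∷ (Adj⇒≢ G yb ∷ []) ∷ [] ∷ [])
    (wx ∷ wa ∷ wy ∷ wb ∷ xa ∷ Adj-sym G ya ∷ yb ∷ Adj-sym G xb ∷ [])

all⁵? : {P : Vec (Fin 2) 5 → Set} → Decidable P → Dec (∀ a b c d e → P (a ∷ b ∷ c ∷ d ∷ e ∷ []))
all⁵? P? = all? λ a → all? λ b → all? λ c → all? λ d → all? λ e → P? (a ∷ b ∷ c ∷ d ∷ e ∷ [])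

Crowded : (Fin 5 → Fin 2) → Set
Crowded c = ∃[ y ] ∃[ x ] Adj W₄ y x × c x ≡ c y × ∃[ z ] x ≢ z × Adj W₄ y z × c z ≡ c y

Majority : (Fin 5 → Fin 2) → Set
Majority c = ∃[ i ] ∃[ j ] i ≢ j × c i ≡ c j × ∃[ k ] i ≢ k × j ≢ k × c k ≡ c j

opaque

  -- By exhaustion over 32 colourings. Consequently a graph with two sides, each inducing a
  -- matching, contains no `W₄`.
  crowded-lookup : ∀ a b c d e → Crowded (lookup (a ∷ b ∷ c ∷ d ∷ e ∷ []))
  crowded-lookup = from-yes (all⁵? λ v → any? λ y → any? λ x →
    T? (adj W₄ y x) ×-dec lookup v x ≟ lookup v y ×-dec any? λ z →
    ¬? (x ≟ z) ×-dec T? (adj W₄ y z) ×-dec lookup v z ≟ lookup v y)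

  majority-lookup : ∀ a b c d e → Majority (lookup (a ∷ b ∷ c ∷ d ∷ e ∷ []))
  majority-lookup = from-yes (all⁵? λ v → any? λ i → any? λ j →
    ¬? (i ≟ j) ×-dec lookup v i ≟ lookup v j ×-dec any? λ k →
    ¬? (i ≟ k) ×-dec ¬? (j ≟ k) ×-dec lookup v k ≟ lookup v j)

opaque

  transfer : ∀ (c : Fin 5 → Fin 2) i j → let v = c 0F ∷ c 1F ∷ c 2F ∷ c 3F ∷ c 4F ∷ [] in
    lookup v i ≡ lookup v j → c i ≡ c j
  transfer c i j eq = trans (sym (lookup-5 c i)) (trans eq (lookup-5 c j))

  crowded : ∀ c → Crowded c
  crowded c =
    let y , x , yx , cx , z , x≢z , yz , cz = crowded-lookup (c 0F) (c 1F) (c 2F) (c 3F) (c 4F)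
    in y , x , yx , transfer c x y cx , z , x≢z , yz , transfer c z y cz

  majority : ∀ c → Majority c
  majority c =
    let i , j , i≢j , ij , k , i≢k , j≢k , kj = majority-lookup (c 0F) (c 1F) (c 2F) (c 3F) (c 4F)
    in i , j , i≢j , transfer c i j ij , k , i≢k , j≢k , transfer c k j kj

-- K₂ₖ,₂ₖ with a perfect matching added to the side 1F.
module MatchedBipartite (k-1 : ℕ) where

  k : ℕ
  k = suc k-1

  X : Set
  X = Fin 2 × (Fin k × Fin 2)

  R : X → X → Set
  R (0F , _)     (0F , _)     = ⊥
  R (1F , i , a) (1F , j , b) = i ≡ j × a ≢ b
  R (0F , _)     (1F , _)     = ⊤
  R (1F , _)     (0F , _)     = ⊤

  R? : B.Decidable R
  R? (0F , _)     (0F , _)     = no λ ()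
  R? (1F , i , a) (1F , j , b) = i ≟ j ×-dec ¬? (a ≟ b)
  R? (0F , _)     (1F , _)     = yes tt
  R? (1F , _)     (0F , _)     = yes tt

  R-sym : ∀ x y → R x y → R y x
  R-sym (1F , _) (1F , _) (i≡j , a≢b) = sym i≡j , a≢b ∘ sym
  R-sym (0F , _) (1F , _) _ = tt
  R-sym (1F , _) (0F , _) _ = tt

  R-irrefl : ∀ x → ¬ R x x
  R-irrefl (1F , _) (_ , a≢a) = a≢a refl

  X↔ : Fin (2 * (k * 2)) ↔ X
  X↔ = ↔-trans *↔× (↔-refl ×-↔ *↔×)

  open FromRelation X↔ R R? R-sym R-irrefl public

  side : X → Fin 2
  side = proj₁

  other : ∀ {a b c : Fin 2} → a ≢ b → a ≢ c → b ≡ c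
  other {0F} {0F} {c}  a≢b a≢c = contradiction refl a≢b
  other {0F} {1F} {0F} a≢b a≢c = contradiction refl a≢c
  other {0F} {1F} {1F} a≢b a≢c = refl
  other {1F} {1F} {c}  a≢b a≢c = contradiction refl a≢b
  other {1F} {0F} {1F} a≢b a≢c = contradiction refl a≢c
  other {1F} {0F} {0F} a≢b a≢c = refl

  same-side : ∀ y x z → R y x → R y z → side x ≡ side y → side z ≡ side y → x ≡ z
  same-side (1F , i , a) (1F , _ , b) (1F , _ , c) (refl , a≢b) (refl , a≢c) refl refl =
    cong (λ d → 1F , i , d) (other a≢b a≢c)

  free : W₄ -Free relGraph
  free (f , inj , hom) =
    let y , x , yx , cx , z , x≢z , yz , cz = crowded (side ∘ to ∘ f)
    in x≢z (inj x z (to-injective (same-side (to (f y)) (to (f x)) (to (f z))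
         (adj⇒R (f y) (f x) (hom y x yx)) (adj⇒R (f y) (f z) (hom y z yz)) cx cz)))

  degree≥ : ∀ v → k * 2 ≤ degree relGraph v
  degree≥ v = injection⇒≤degree v (λ i → flip (side (to v)) , Inverse.to *↔× i)
    (↔-injective (*↔× {k} {2}) ∘ cong proj₂) λ i → R-flip (to v) (Inverse.to *↔× i)
    where
    flip : Fin 2 → Fin 2
    flip 0F = 1F
    flip 1F = 0F
    R-flip : ∀ x y → R x (flip (side x) , y)
    R-flip (0F , _) y = tt
    R-flip (1F , _) y = tt

  module _ (G : Spanning (order relGraph)) (⊆G : spanning relGraph ⊆ᴱ G) (W₄-free : W₄ -Free graph G) where

    left : Fin k → Fin 2 → V relGraph
    left i a = from (1F , i , a)

    left-injective : ∀ i a j b → left i a ≡ left j b → i ≡ j × a ≡ b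
    left-injective i a j b eq with from-injective {1F , i , a} {1F , j , b} eq
    ... | refl = refl , refl

    right : Fin 2 → V relGraph
    right a = from (0F , zero , a)

    cross : ∀ i a b → Adj (graph G) (left i a) (right b)
    cross i a b = ⊆G (left i a) (right b) (R⇒adj (1F , i , a) (0F , zero , b) tt)

    matched : ∀ i → Adj (graph G) (left i 1F) (left i 0F)
    matched i = ⊆G (left i 1F) (left i 0F) (R⇒adj (1F , i , 1F) (1F , i , 0F) (refl , λ ()))

    -- The edge would make `left i 1F` the hub of a wheel whose rim alternates between its two left
    -- neighbours and two right vertices.
    unmatched : ∀ i j → i ≢ j → ¬ Adj (graph G) (left i 1F) (left j 0F)
    unmatched i j i≢j ij = W₄-free (W₄-⊑ (graph G) {left i 1F} {left i 0F} {left j 0F} {right 0F} {right 1F}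
      (i≢j ∘ proj₁ ∘ left-injective i 0F j 0F)
      (λ eq → contradiction (from-injective {0F , zero , 0F} {0F , zero , 1F} eq) λ ())
      (matched i) ij (cross i 1F 0F) (cross i 1F 1F)
      (cross i 0F 0F) (cross i 0F 1F) (cross j 0F 0F) (cross j 0F 1F))

    blowup⇒≤ : ∀ F → graph G IsBlowupOf F → k ≤ order F
    blowup⇒≤ F (φ , φ-adj) = Fin.injective⇒≤ {f = λ i → φ (left i 0F)} λ {i} {j} eq →
      decidable-stable (i ≟ j) λ i≢j → unmatched i j i≢j
        (Equivalence.from (φ-adj (left i 1F) (left j 0F))
          (subst (Adj F (φ (left i 1F))) eq (Equivalence.to (φ-adj (left i 1F) (left i 0F)) (matched i))))

δB-W₄ : ¬ threshold δB W₄ (1 ÷ 2)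
δB-W₄ (γ , (_ , F , blowup) , γ<q) = maximal-extension W₄ relGraph free λ (G , ⊆G , maximal) →
  ℕ.<⇒≱ ℕ.≤-refl (blowup⇒≤ G ⊆G (proj₁ maximal) F
    (blowup (graph G) maximal (minDegree≥⁺ (graph G) γ 1 2 γ<q (dense G ⊆G))))
  where
  -- This makes k one more than the order of `F`.
  open MatchedBipartite (order F)
  dense : ∀ G → spanning relGraph ⊆ᴱ G → 1 * order relGraph ≤ 2 * minDegree (graph G)
  dense G ⊆G = ℕ.≤-trans (ℕ.≤-reflexive (ℕ.*-identityˡ (order relGraph)))
    (ℕ.*-monoʳ-≤ 2 (≤minDegree (graph G) (ℕ.m≤n*m (k * 2) 2)
      λ v → ℕ.≤-trans (degree≥ v) (degree-mono (spanning relGraph) G ⊆G v)))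

-- Maximal W₄-free graphs of minimum degree near half the order

module TwoTypes (G : Graph) (maximal : W₄ -MaximalFree G) (type : V G → Fin 2)
  (matching : ∀ y x z → x ≢ z → Adj G y x → Adj G y z → type x ≡ type y → type z ≡ type y → ⊥) where

  -- Adding an edge between the types leaves a matching inside each type, hence creates no W₄.
  opposite-adjacent : ∀ u v → type u ≢ type v → Adj G u v
  opposite-adjacent u v tu≢tv = decidable-stable (T? (adj G u v)) λ ¬uv →
    let u≢v = tu≢tv ∘ cong type
        f , inj , hom = proj₂ maximal u v u≢v ¬uv
        y , x , yx , cx , z , x≢z , yz , cz = crowded (type ∘ f)
    in matching (f y) (f x) (f z) (x≢z ∘ inj x z)
         (old (f y) (f x) (sym cx) u≢v (hom y x yx)) (old (f y) (f z) (sym cz) u≢v (hom y z yz)) cx cz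
    where
    old : ∀ p q → type p ≡ type q → (u≢v : u ≢ v) → Adj (addEdge G u v u≢v) p q → Adj G p q
    old p q same u≢v pq with addEdge-inv G u≢v {p} {q} pq
    ... | inj₁ pq∈G                 = pq∈G
    ... | inj₂ (inj₁ (refl , refl)) = contradiction same tu≢tv
    ... | inj₂ (inj₂ (refl , refl)) = contradiction (sym same) tu≢tv

  -- Three of any five elements share a type. A vertex seeing just two of them misses the third,
  -- hence has that type too, and then has two neighbours of its own type.
  shattered-small : ∀ S → Shattered G S → ∣ S ∣ ≤ 4
  shattered-small S shattered = ℕ.≮⇒≥ λ 5≤ →
    let s , s∈ , inj = enumerate 5 S 5≤
        i , j , i≢j , ij , k , i≢k , j≢k , kj = majority (type ∘ s)
        T = ⁅ s i ⁆ ∪ ⁅ s j ⁆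
        T⊆S : T ⊆ S
        T⊆S x∈T = [ (λ x∈ → subst (_∈ S) (sym (x∈⁅y⁆⇒x≡y (s i) x∈)) (s∈ i))
                  , (λ x∈ → subst (_∈ S) (sym (x∈⁅y⁆⇒x≡y (s j) x∈)) (s∈ j)) ]′ (x∈p∪q⁻ ⁅ s i ⁆ ⁅ s j ⁆ x∈T)
        v , Nv∩S≡T = shattered T T⊆S
        v~ : ∀ {x} → x ∈ T → Adj G v x
        v~ x∈T = ∈N⁻ G (proj₁ (x∈p∩q⁻ (N G v) S (subst (_ ∈_) (sym Nv∩S≡T) x∈T)))
        sk∉T : s k ∉ T
        sk∉T sk∈T = [ (λ x∈ → i≢k (sym (inj (x∈⁅y⁆⇒x≡y (s i) x∈))))
                    , (λ x∈ → j≢k (sym (inj (x∈⁅y⁆⇒x≡y (s j) x∈)))) ]′ (x∈p∪q⁻ ⁅ s i ⁆ ⁅ s j ⁆ sk∈T)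
        v≁sk : ¬ Adj G v (s k)
        v≁sk vk = sk∉T (subst (s k ∈_) Nv∩S≡T (x∈p∩q⁺ (∈N⁺ G vk , s∈ k)))
        tv≡tk : type v ≡ type (s k)
        tv≡tk = decidable-stable (type v ≟ type (s k)) (v≁sk ∘ opposite-adjacent v (s k))
        tj≡tv : type (s j) ≡ type v
        tj≡tv = trans (sym kj) (sym tv≡tk)
    in matching v (s i) (s j) (i≢j ∘ inj)
         (v~ (x∈p∪q⁺ (inj₁ (x∈⁅x⁆ (s i))))) (v~ (x∈p∪q⁺ (inj₂ (x∈⁅x⁆ (s j)))))
         (trans ij tj≡tv) tj≡tv

-- D has no room outside B: little of it lies in A, and A ∪ B covers almost everything.
almost-contains : ∀ {n} e s (A B D : Subset n) → n ≤ 2 * ∣ A ∣ + e → n ≤ 2 * ∣ D ∣ + e →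
  ∣ A ∩ B ∣ ≤ e → ∣ D ∩ A ∣ ≤ s → ∣ B ─ D ∣ ≤ 2 * e + s
almost-contains {n} e s A B D A-large D-large AB DA = ℕ.≮⇒≥ λ contra → farkas {11}
  (λ a b ab u o d da db m e s →
    (2 ∙ db ⊕ m ⊴ b) ∷ (2 ∙ d ⊴ da ⊕ (db ⊕ o)) ∷ (1 ∙ u ⊕ o ⊴ 2 ⊛ d ⊕ e) ∷ (2 ∙ da ⊴ s)
    ∷ (2 ∙ a ⊕ b ⊴ u ⊕ ab) ∷ (2 ∙ ab ⊴ e) ∷ (1 ∙ u ⊕ o ⊴ 2 ⊛ a ⊕ e) ∷ (2 ∙ con 1 ⊕ (2 ⊛ e ⊕ s) ⊴ m) ∷ [])
  (∣ A ∣ ∷ ∣ B ∣ ∷ ∣ A ∩ B ∣ ∷ ∣ A ∪ B ∣ ∷ ∣ outer ∣ ∷ ∣ D ∣ ∷ ∣ D ∩ A ∣ ∷ ∣ D ∩ B ∣ ∷ ∣ B ─ D ∣ ∷ e ∷ s ∷ [])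
  (subst (λ p → ∣ p ∣ + ∣ B ─ D ∣ ≤ ∣ B ∣) (∩-comm B D) (∣p∩q∣+∣p─q∣≤∣p∣ B D)
    ∷ D-split
    ∷ subst (_≤ 2 * ∣ D ∣ + e) (sym total) D-large
    ∷ DA
    ∷ ℕ.≤-reflexive (sym (∣p∪q∣+∣p∩q∣ A B))
    ∷ AB
    ∷ subst (_≤ 2 * ∣ A ∣ + e) (sym total) A-large
    ∷ contra ∷ [])
  where
  outer : Subset n
  outer = ∁ (A ∪ B)
  total : ∣ A ∪ B ∣ + ∣ outer ∣ ≡ n
  total = trans (cong (∣ A ∪ B ∣ +_) (∣∁p∣≡n∸∣p∣ (A ∪ B))) (ℕ.m+[n∸m]≡n (∣p∣≤n (A ∪ B)))
  cover : D ⊆ (D ∩ A) ∪ ((D ∩ B) ∪ outer)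
  cover {x} x∈D with x ∈? A | x ∈? B
  ... | yes x∈A | _       = x∈p∪q⁺ (inj₁ (x∈p∩q⁺ (x∈D , x∈A)))
  ... | no  _   | yes x∈B = x∈p∪q⁺ (inj₂ (x∈p∪q⁺ (inj₁ (x∈p∩q⁺ (x∈D , x∈B)))))
  ... | no  x∉A | no  x∉B = x∈p∪q⁺ (inj₂ (x∈p∪q⁺ (inj₂ (x∉p⇒x∈∁p
    ([ x∉A , x∉B ]′ ∘ x∈p∪q⁻ A B)))))
  D-split : ∣ D ∣ ≤ ∣ D ∩ A ∣ + (∣ D ∩ B ∣ + ∣ outer ∣)
  D-split = ℕ.≤-trans (p⊆q⇒∣p∣≤∣q∣ cover) (ℕ.≤-trans (∣p∪q∣≤∣p∣+∣q∣ (D ∩ A) _)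
    (ℕ.+-monoʳ-≤ ∣ D ∩ A ∣ (∣p∪q∣≤∣p∣+∣q∣ (D ∩ B) outer)))

-- G is nearly complete bipartite: the two sides are told apart by the neighbourhoods A and B
-- of an edge whose ends have few common neighbours.  The unit of error is e ≈ n/100; at most 200
-- almost disjoint sets of size > e fit into n ≤ 200e vertices.
module DenseW₄Free (G : Graph) (maximal : W₄ -MaximalFree G) (e : ℕ) (e-large : 50000 ≤ e)
  (e≤ : 100 * e ≤ order G) (≤e : order G ≤ 200 * e) (dense : ∀ v → order G ≤ 2 * degree G v + e) where

  n : ℕ
  n = order G

  -- Two vertices a, b in the intersection would give a wheel with hub w and rim x a y b.
  ∣N³∣≤1 : ∀ w x y → x ≢ y → Adj G w x → Adj G w y → ∣ N G w ∩ (N G x ∩ N G y) ∣ ≤ 1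
  ∣N³∣≤1 w x y x≢y wx wy = ∣p∣≤1 (N G w ∩ (N G x ∩ N G y)) λ {a} {b} a∈ b∈ →
    decidable-stable (a ≟ b) λ a≢b →
      let wa , xya = x∈p∩q⁻ (N G w) (N G x ∩ N G y) a∈
          xa , ya  = x∈p∩q⁻ (N G x) (N G y) xya
          wb , xyb = x∈p∩q⁻ (N G w) (N G x ∩ N G y) b∈
          xb , yb  = x∈p∩q⁻ (N G x) (N G y) xyb
      in proj₁ maximal (W₄-⊑ G x≢y a≢b wx wy (∈N⁻ G wa) (∈N⁻ G wb)
           (∈N⁻ G xa) (∈N⁻ G xb) (∈N⁻ G ya) (∈N⁻ G yb))

  near? : ∀ v x → Dec (Adj G v x × suc e ≤ ∣ N G v ∩ N G x ∣)
  near? v x = T? (adj G v x) ×-dec suc e ≤? ∣ N G v ∩ N G x ∣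

  near : V G → Subset n
  near v = subset (near? v)

  -- The common neighbourhoods of v with vertices near it are larger than e, and by `∣N³∣≤1` any two
  -- share at most one vertex.
  near-bonferroni : ∀ v k → k ≤ ∣ near v ∣ → k * suc e ≤ n + 1 * (k * k)
  near-bonferroni v k many =
    bonferroni (suc e) 1 P (λ i → proj₂ (∈-subset⁻ (near? v) (f∈ i))) small
    where
    chosen = enumerate k (near v) many
    f : Fin k → V G
    f = proj₁ chosen
    f∈ : ∀ i → f i ∈ near v
    f∈ = proj₁ (proj₂ chosen)
    P : Fin k → Subset n
    P i = N G v ∩ N G (f i)
    small : ∀ i j → i ≢ j → ∣ P i ∩ P j ∣ ≤ 1
    small i j i≢j = ℕ.≤-trans
      (p⊆q⇒∣p∣≤∣q∣ λ x∈ →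
        let x∈i , x∈j = x∈p∩q⁻ (P i) (P j) x∈
            v∋x , i∋x = x∈p∩q⁻ (N G v) (N G (f i)) x∈i
            _   , j∋x = x∈p∩q⁻ (N G v) (N G (f j)) x∈j
        in x∈p∩q⁺ (v∋x , x∈p∩q⁺ (i∋x , j∋x)))
      (∣N³∣≤1 v (f i) (f j) (i≢j ∘ proj₂ (proj₂ chosen))
        (proj₁ (∈-subset⁻ (near? v) (f∈ i))) (proj₁ (∈-subset⁻ (near? v) (f∈ j))))

  ∣near∣≤200 : ∀ v → ∣ near v ∣ ≤ 200
  ∣near∣≤200 v = ℕ.≮⇒≥ λ many → farkas {2}
    -- 40401 is 201 squared; together with n ≤ 200 e the inequality would force e ≤ 40200.
    (λ n e → (1 ∙ 201 ⊛ (con 1 ⊕ e) ⊴ n ⊕ con 40401) ∷ (1 ∙ n ⊴ 200 ⊛ e) ∷ (1 ∙ con 50000 ⊴ e) ∷ [])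
    (n ∷ e ∷ []) (near-bonferroni v 201 many ∷ ≤e ∷ e-large ∷ [])

  0<n : 0 < n
  0<n = ℕ.≰⇒> λ n≤0 → farkas {2}
    (λ n e → (1 ∙ n ⊴ con 0) ∷ (1 ∙ 100 ⊛ e ⊴ n) ∷ (100 ∙ con 50000 ⊴ e) ∷ [])
    (n ∷ e ∷ []) (n≤0 ∷ e≤ ∷ e-large ∷ [])

  v₀ : V G
  v₀ = Fin.fromℕ< 0<n

  far-neighbour : ∃[ u ] u ∈ N G v₀ × u ∉ near v₀
  far-neighbour = ∣q∣<∣p∣⇒∃ (N G v₀) (near v₀) (ℕ.≤-trans (s≤s (∣near∣≤200 v₀)) (ℕ.≰⇒> λ small → farkas {3}
    (λ n e d → (1 ∙ n ⊴ 2 ⊛ d ⊕ e) ∷ (2 ∙ d ⊴ con 200) ∷ (1 ∙ 100 ⊛ e ⊴ n) ∷ (99 ∙ con 50000 ⊴ e) ∷ [])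
    (n ∷ e ∷ degree G v₀ ∷ []) (dense v₀ ∷ small ∷ e≤ ∷ e-large ∷ [])))

  u₀ : V G
  u₀ = proj₁ far-neighbour

  A B : Subset n
  A = N G v₀
  B = N G u₀

  far : ∀ v x → Adj G v x → x ∉ near v → ∣ N G v ∩ N G x ∣ ≤ e
  far v x vx x∉ = ℕ.≮⇒≥ λ many → x∉ (∈-subset⁺ (near? v) (vx , many))

  A∩B≤e : ∣ A ∩ B ∣ ≤ e
  A∩B≤e = far v₀ u₀ (∈N⁻ G (proj₁ (proj₂ far-neighbour))) (proj₂ (proj₂ far-neighbour))

  ∣B─N∣≤ : ∀ x s → ∣ N G x ∩ A ∣ ≤ s → ∣ B ─ N G x ∣ ≤ 2 * e + s
  ∣B─N∣≤ x s = almost-contains e s A B (N G x) (dense v₀) (dense x) A∩B≤e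

  ∣A─N∣≤ : ∀ x s → ∣ N G x ∩ B ∣ ≤ s → ∣ A ─ N G x ∣ ≤ 2 * e + s
  ∣A─N∣≤ x s = almost-contains e s B A (N G x) (dense u₀) (dense x)
    (subst (λ p → ∣ p ∣ ≤ e) (∩-comm A B) A∩B≤e)

  -- To be combined with `∣N³∣≤1`: if q and r miss little of C, then p meets C in little.
  ─-cover : ∀ (C p q r : Subset n) → ∣ p ∩ C ∣ ≤ ∣ C ─ q ∣ + (∣ C ─ r ∣ + ∣ p ∩ (q ∩ r) ∣)
  ─-cover C p q r = ℕ.≤-trans (p⊆q⇒∣p∣≤∣q∣ cover)
    (ℕ.≤-trans (∣p∪q∣≤∣p∣+∣q∣ (C ─ q) _) (ℕ.+-monoʳ-≤ ∣ C ─ q ∣ (∣p∪q∣≤∣p∣+∣q∣ (C ─ r) _)))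
    where
    cover : p ∩ C ⊆ (C ─ q) ∪ ((C ─ r) ∪ (p ∩ (q ∩ r)))
    cover {x} x∈ with x∈p∩q⁻ p C x∈ | x ∈? q | x ∈? r
    ... | x∈p , x∈C | no  x∉q | _       = x∈p∪q⁺ (inj₁ (x∈p∧x∉q⇒x∈p─q x∈C x∉q))
    ... | x∈p , x∈C | yes x∈q | no  x∉r = x∈p∪q⁺ (inj₂ (x∈p∪q⁺ (inj₁ (x∈p∧x∉q⇒x∈p─q x∈C x∉r))))
    ... | x∈p , x∈C | yes x∈q | yes x∈r = x∈p∪q⁺ (inj₂ (x∈p∪q⁺ (inj₂ (x∈p∩q⁺ (x∈p , x∈p∩q⁺ (x∈q , x∈r))))))

  -- Two far neighbours x, y of w in A are joined to almost all of B, so w sees little of B.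
  few-in-B : ∀ w → 202 ≤ ∣ N G w ∩ A ∣ → ∣ N G w ∩ B ∣ ≤ 7 * e
  few-in-B w many = ℕ.≮⇒≥ λ contra → farkas {5}
    (λ e b x y c → (1 ∙ con 1 ⊕ 7 ⊛ e ⊴ b) ∷ (1 ∙ b ⊴ x ⊕ (y ⊕ c)) ∷ (1 ∙ x ⊴ 2 ⊛ e ⊕ e) ∷ (1 ∙ y ⊴ 2 ⊛ e ⊕ e)
      ∷ (1 ∙ c ⊴ con 1) ∷ (1 ∙ con 50000 ⊴ e) ∷ [])
    (e ∷ ∣ N G w ∩ B ∣ ∷ ∣ B ─ N G x ∣ ∷ ∣ B ─ N G y ∣ ∷ ∣ N G w ∩ (N G x ∩ N G y) ∣ ∷ [])
    (contra ∷ ─-cover B (N G w) (N G x) (N G y) ∷ miss 0F ∷ miss 1F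
      ∷ ∣N³∣≤1 w x y (λ eq → contradiction (inj {0F} {1F} eq) λ ()) (w~ 0F) (w~ 1F) ∷ e-large ∷ [])
    where
    candidates : Subset n
    candidates = (N G w ∩ A) ─ near v₀
    -- At most 200 vertices are near `v₀`, so 202 neighbours in `A` leave two far ones.
    two : 2 ≤ ∣ candidates ∣
    two = ℕ.+-cancelʳ-≤ 200 2 ∣ candidates ∣ (ℕ.≤-trans many (ℕ.≤-trans (∣p∣≤∣p─q∣+∣p∩q∣ (N G w ∩ A) (near v₀))
      (ℕ.+-monoʳ-≤ ∣ candidates ∣ (ℕ.≤-trans (∣p∩q∣≤∣q∣ (N G w ∩ A) (near v₀)) (∣near∣≤200 v₀)))))
    pair = enumerate 2 candidates two
    z : Fin 2 → V G
    z = proj₁ pair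
    x y : V G
    x = z 0F
    y = z 1F
    inj : Injective _≡_ _≡_ z
    inj = proj₂ (proj₂ pair)
    z∈ : ∀ i → z i ∈ N G w × z i ∈ A × z i ∉ near v₀
    z∈ i = let z∈wA , z∉ = x∈p─q⁻ (N G w ∩ A) (near v₀) (proj₁ (proj₂ pair) i)
               z∈w , z∈A = x∈p∩q⁻ (N G w) A z∈wA
           in z∈w , z∈A , z∉
    w~ : ∀ i → Adj G w (z i)
    w~ i = ∈N⁻ G (proj₁ (z∈ i))
    miss : ∀ i → ∣ B ─ N G (z i) ∣ ≤ 2 * e + e
    miss i = ∣B─N∣≤ (z i) e (subst (λ p → ∣ p ∣ ≤ e) (∩-comm A (N G (z i)))
      (far v₀ (z i) (∈N⁻ G (proj₁ (proj₂ (z∈ i)))) (proj₂ (proj₂ (z∈ i)))))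

  many? : ∀ w → Dec (202 ≤ ∣ N G w ∩ A ∣)
  many? w = 202 ≤? ∣ N G w ∩ A ∣

  typeOf : ∀ {P : Set} → Dec P → Fin 2
  typeOf (yes _) = 1F
  typeOf (no  _) = 0F

  type : V G → Fin 2
  type w = typeOf (many? w)

  opposite : Fin 2 → Subset n
  opposite 0F = B
  opposite 1F = A

  opposite-large : ∀ t → n ≤ 2 * ∣ opposite t ∣ + e
  opposite-large 0F = dense u₀
  opposite-large 1F = dense v₀

  -- Type 1 vertices see at most 7 e of `B`, type 0 vertices at most 201 of `A`; in both cases the
  -- other set is almost contained in the neighbourhood.
  ∣opposite─N∣≤ : ∀ w → ∣ opposite (type w) ─ N G w ∣ ≤ 9 * e
  ∣opposite─N∣≤ w = bound (many? w)
    where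
    lemma : ∀ e → 2 * e + 7 * e ≡ 9 * e
    lemma = solve-∀
    bound : (m? : Dec (202 ≤ ∣ N G w ∩ A ∣)) → ∣ opposite (typeOf m?) ─ N G w ∣ ≤ 9 * e
    bound (yes many) = ℕ.≤-trans (∣A─N∣≤ w (7 * e) (few-in-B w many)) (ℕ.≤-reflexive (lemma e))
    bound (no  few)  = ℕ.≮⇒≥ λ contra → farkas {2}
      (λ e m → (1 ∙ con 1 ⊕ 9 ⊛ e ⊴ m) ∷ (1 ∙ m ⊴ 2 ⊛ e ⊕ con 201) ∷ (7 ∙ con 50000 ⊴ e) ∷ [])
      (e ∷ ∣ B ─ N G w ∣ ∷ []) (contra ∷ ∣B─N∣≤ w 201 (ℕ.≤-pred (ℕ.≰⇒> few)) ∷ e-large ∷ [])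

  -- Vertices of one type each miss at most 9 e of a set of size at least 49.5 e, so y, x, z would
  -- have more than one common neighbour.
  matching : ∀ y x z → x ≢ z → Adj G y x → Adj G y z → type x ≡ type y → type z ≡ type y → ⊥
  matching y x z x≢z yx yz x≡y z≡y = farkas {7}
    (λ n e c q my mx k → (1 ∙ n ⊴ 2 ⊛ c ⊕ e) ∷ (2 ∙ c ⊴ my ⊕ q) ∷ (2 ∙ my ⊴ 9 ⊛ e) ∷ (2 ∙ q ⊴ mx ⊕ k)
      ∷ (2 ∙ mx ⊴ 9 ⊛ e) ∷ (2 ∙ k ⊴ 9 ⊛ e ⊕ con 1) ∷ (1 ∙ 100 ⊛ e ⊴ n) ∷ (45 ∙ con 50000 ⊴ e) ∷ [])
    (n ∷ e ∷ ∣ C ∣ ∷ ∣ N G y ∩ C ∣ ∷ ∣ C ─ N G y ∣ ∷ ∣ C ─ N G x ∣ ∷ ∣ C ─ N G z ∣ + ∣ N G y ∩ (N G x ∩ N G z) ∣ ∷ [])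
    (opposite-large (type y)
      ∷ subst (λ p → ∣ C ∣ ≤ ∣ C ─ N G y ∣ + ∣ p ∣) (∩-comm C (N G y)) (∣p∣≤∣p─q∣+∣p∩q∣ C (N G y))
      ∷ ∣opposite─N∣≤ y
      ∷ ─-cover C (N G y) (N G x) (N G z)
      ∷ subst (λ t → ∣ opposite t ─ N G x ∣ ≤ 9 * e) x≡y (∣opposite─N∣≤ x)
      ∷ ℕ.+-mono-≤ (subst (λ t → ∣ opposite t ─ N G z ∣ ≤ 9 * e) z≡y (∣opposite─N∣≤ z)) (∣N³∣≤1 y x z x≢z yx yz)
      ∷ e≤ ∷ e-large ∷ [])
    where
    C : Subset n
    C = opposite (type y)

  VC≤4 : VC G ≤ 4
  VC≤4 = VC≤ G (TwoTypes.shattered-small G maximal type matching)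

-- The degree condition gives n ≤ 2 d + n/200, and n/200 is at most e, the rounded n/100, once e is
-- large. For small e the order itself bounds the dimension.
W₄-VC-bounded : ∀ G → W₄ -MaximalFree G → 199 * order G ≤ 400 * minDegree G → VC G ≤ 100 * 50000
W₄-VC-bounded G maximal dense = bound (50000 ≤? e)
  where
  n e r : ℕ
  n = order G
  e = n / 100
  r = n % 100
  n≡ : n ≡ r + 100 * e
  n≡ = trans (m≡m%n+[m/n]*n n 100) (cong (r +_) (ℕ.*-comm e 100))
  100e≤n : 100 * e ≤ n
  100e≤n = subst (100 * e ≤_) (sym n≡) (ℕ.m≤n+m (100 * e) r)
  n≤ : suc n ≤ 100 + 100 * e
  n≤ = subst (λ m → suc m ≤ 100 + 100 * e) (sym n≡) (ℕ.+-monoˡ-≤ (100 * e) (m%n<n n 100))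
  bound : Dec (50000 ≤ e) → VC G ≤ 100 * 50000
  bound (no small) = VC≤ G λ S _ → ℕ.≤-trans (∣p∣≤n S) (ℕ.≮⇒≥ λ contra → farkas {2}
    (λ n e → (1 ∙ con 1 ⊕ con 5000000 ⊴ n) ∷ (1 ∙ con 1 ⊕ n ⊴ con 100 ⊕ 100 ⊛ e) ∷ (100 ∙ con 1 ⊕ e ⊴ con 50000) ∷ [])
    (n ∷ e ∷ []) (contra ∷ n≤ ∷ ℕ.≰⇒> small ∷ []))
  bound (yes large) = ℕ.≤-trans VC≤4 (ℕ.m≤m+n 4 4999996)
    where
    n≤200e : n ≤ 200 * e
    n≤200e = ℕ.≮⇒≥ λ contra → farkas {2}
      (λ n e → (1 ∙ con 1 ⊕ 200 ⊛ e ⊴ n) ∷ (1 ∙ con 1 ⊕ n ⊴ con 100 ⊕ 100 ⊛ e) ∷ (100 ∙ con 50000 ⊴ e) ∷ [])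
      (n ∷ e ∷ []) (contra ∷ n≤ ∷ large ∷ [])
    n≤2d+e : ∀ v → n ≤ 2 * degree G v + e
    n≤2d+e v = ℕ.≮⇒≥ λ contra → farkas {4}
      (λ n e d m → (200 ∙ con 1 ⊕ (2 ⊛ d ⊕ e) ⊴ n) ∷ (1 ∙ 199 ⊛ n ⊴ 400 ⊛ m) ∷ (400 ∙ m ⊴ d) ∷ (1 ∙ n ⊴ 200 ⊛ e) ∷ [])
      (n ∷ e ∷ degree G v ∷ minDegree G ∷ []) (contra ∷ dense ∷ minDegree≤ G v ∷ n≤200e ∷ [])
    open DenseW₄Free G maximal e large 100e≤n n≤200e n≤2d+e using (VC≤4)

δVC-W₄ : threshold δVC W₄ (1 ÷ 2)
-- An admissible value strictly between 199/400 and 1/2.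
δVC-W₄ = rational (399 ÷ 800) ,
  ((λ q r<q → ℚ.<-trans (÷-positive 399 800 z<s) r<q) , 100 * 50000 , λ G maximal dense →
    W₄-VC-bounded G maximal (minDegree≥⁻ G 199 400 399 800 (from-yes (199 * 800 <? 399 * 400)) dense)) ,
  ÷-< 399 800 1 2 (from-yes (399 * 2 <? 1 * 800))

-- The six separations

C₅∪NK₁ : Graph
C₅∪NK₁ = C₅ ⊎K₁× colours 12

enough : colours 12 ≤ 4 + colours 12
enough = ℕ.m≤n+m (colours 12) 4

δχ≄δhom : threshold δχ C₄∪K₁ ≄ threshold δhom C₄∪K₁
δχ≄δhom =
  let G , thin , non = thin-nonColourable 4
      m , ¬δhom      = δhom-C₄∪K₁ G thin non
  in separate δχ δhom C₄∪K₁ (1 ÷ suc m) (δχ-C₄∪K₁ (suc m)) ¬δhom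

δχ≄δVC : threshold δχ C₅∪NK₁ ≄ threshold δVC C₅∪NK₁
δχ≄δVC = separate δχ δVC C₅∪NK₁ (1 ÷ 10) (δχ-C₅∪NK₁ (colours 12) enough) (δVC-C₅∪NK₁ (colours 12))

δχ≄δB : threshold δχ C₅∪NK₁ ≄ threshold δB C₅∪NK₁
δχ≄δB = separate δχ δB C₅∪NK₁ (1 ÷ 10) (δχ-C₅∪NK₁ (colours 12) enough) (δB-C₅∪NK₁ (colours 12))

δhom≄δVC : threshold δhom C₅∪NK₁ ≄ threshold δVC C₅∪NK₁
δhom≄δVC = separate δhom δVC C₅∪NK₁ (1 ÷ 10) (δhom-C₅∪NK₁ (colours 12) enough) (δVC-C₅∪NK₁ (colours 12))

δhom≄δB : threshold δhom C₅∪NK₁ ≄ threshold δB C₅∪NK₁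
δhom≄δB = separate δhom δB C₅∪NK₁ (1 ÷ 10) (δhom-C₅∪NK₁ (colours 12) enough) (δB-C₅∪NK₁ (colours 12))

δVC≄δB : threshold δVC W₄ ≄ threshold δB W₄
δVC≄δB = separate δVC δB W₄ (1 ÷ 2) δVC-W₄ δB-W₄

corollary1p6 : (δ* δ** : Parameter) → δ* ≢ δ** →
    Σ Graph λ H → NonZero (order H) × threshold δ* H ≄ threshold δ** H
corollary1p6 δχ   δχ   ≢ = contradiction refl ≢
corollary1p6 δχ   δhom _ = C₄∪K₁ , _ , δχ≄δhom
corollary1p6 δχ   δVC  _ = C₅∪NK₁ , _ , δχ≄δVC
corollary1p6 δχ   δB   _ = C₅∪NK₁ , _ , δχ≄δB
corollary1p6 δhom δχ   _ = C₄∪K₁ , _ , ≄-sym (threshold δχ C₄∪K₁) (threshold δhom C₄∪K₁) δχ≄δhom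
corollary1p6 δhom δhom ≢ = contradiction refl ≢
corollary1p6 δhom δVC  _ = C₅∪NK₁ , _ , δhom≄δVC
corollary1p6 δhom δB   _ = C₅∪NK₁ , _ , δhom≄δB
corollary1p6 δVC  δχ   _ = C₅∪NK₁ , _ , ≄-sym (threshold δχ C₅∪NK₁) (threshold δVC C₅∪NK₁) δχ≄δVC
corollary1p6 δVC  δhom _ = C₅∪NK₁ , _ , ≄-sym (threshold δhom C₅∪NK₁) (threshold δVC C₅∪NK₁) δhom≄δVC
corollary1p6 δVC  δVC  ≢ = contradiction refl ≢
corollary1p6 δVC  δB   _ = W₄ , _ , δVC≄δB
corollary1p6 δB   δχ   _ = C₅∪NK₁ , _ , ≄-sym (threshold δχ C₅∪NK₁) (threshold δB C₅∪NK₁) δχ≄δB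
corollary1p6 δB   δhom _ = C₅∪NK₁ , _ , ≄-sym (threshold δhom C₅∪NK₁) (threshold δB C₅∪NK₁) δhom≄δB
corollary1p6 δB   δVC  _ = W₄ , _ , ≄-sym (threshold δVC W₄) (threshold δB W₄) δVC≄δB
corollary1p6 δB   δB   ≢ = contradiction refl ≢
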